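{- Let $r$ be a constant positive integer and $\varepsilon>0$ a constant. For each $n$, let $L(r,m)=(A\cup B,E)$ be a connected bipartite graph on $m=m(n)$ vertices with bipartition $(A,B)$ such that every vertex in $A$ has at most $r$ neighbors in $B$. If $m=O(n^{1-\varepsilon})$, then $$\lim_{n\to\infty}\frac{\log M_{L(r,m)}(n)}{\binom{n}{2}}=1.$$
   Context: Logarithms are base 2. For graphs $G,G'$ on the same vertex set $[n]$, their symmetric difference $G\oplus G'$ is the graph on $[n]$ whose edge set consists of all edges belonging to exactly one of $G,G'$. For a graph $L$, $M_{L}(n)$ denotes the maximum possible size of a family $\mathcal{G}$ of graphs on vertex set $[n]$ such that for any two distinct $G,G'\in\mathcal{G}$, $G\oplus G'$ contains $L$ as a subgraph. -}

module Defs where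

open import Data.Bool.Base using (Bool; true; false; if_then_else_; not; _∧_; _xor_; T)
open import Data.Bool.Properties as Bool
  using (∧-comm; ∧-idem; ∧-identityʳ; ∧-zeroʳ; T?)
open import Data.Fin.Base using (Fin; zero; suc; funToFin; finToFun)
open import Data.Fin.Properties as Fin
  using (any?; all?; injective⇒≤; finToFun-funToFin)
open import Data.Fin.Subset using (Subset; _∈_; _∩_; _∪_; ⊤; ⊥; ∣_∣)
open import Data.Integer.Base as ℤ using (ℤ; +_; -[1+_]; _⊖_)
import Data.Integer.Properties as ℤ
open import Data.Nat.Base as ℕ
  using (ℕ; zero; suc; NonZero; z≤n; s≤s; z<s; _≤_; _<_; _+_; _*_; _^_)
open import Data.Nat.Combinatorics using (_C_)
import Data.Nat.Properties as ℕ
open import Data.Nat.Solver using (module +-*-Solver)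
open import Data.Rational.Unnormalised.Base as ℚ
  using (ℚᵘ; mkℚᵘ; ↥_; ↧_; ↧ₙ_; 0ℚᵘ; 1ℚᵘ)
import Data.Rational.Unnormalised.Properties as ℚ
open import Data.Product.Base using (Σ; ∃; ∃-syntax; _×_; _,_; proj₁; proj₂)
open import Data.Sum.Base using (_⊎_; inj₁; inj₂)
open import Data.Vec.Base using (tabulate)
open import Function.Base using (_∘_)
open import Function.Bundles using (_⇔_; mk⇔; Equivalence)
open import Function.Definitions using (Injective)
open import Relation.Binary.Construct.Closure.ReflexiveTransitive using (Star)
open import Relation.Binary.PropositionalEquality
  using (_≡_; _≢_; refl; sym; trans; cong; cong₂; subst; subst₂; module ≡-Reasoning)
open import Relation.Nullary
  using (Dec; yes; no; ¬_; ¬?; does; contradiction; _×-dec_; _→-dec_)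
open import Relation.Nullary.Decidable using (map′; decidable-stable; dec-true; dec-false)

------------------------------------------------------------------------
-- Graphs

record Graph (n : ℕ) : Set where
  field
    adj    : Fin n → Fin n → Bool
    symm   : ∀ u v → adj u v ≡ adj v u
    irrefl : ∀ v → adj v v ≡ false

  Adj : Fin n → Fin n → Set
  Adj u v = T (adj u v)

  neighbours : Fin n → Subset n
  neighbours u = tabulate (adj u)

open Graph public

infix 4 _≈_

-- Equality of graphs: without function extensionality, propositional
-- equality of the records is too fine.
_≈_ : ∀ {n} → Graph n → Graph n → Set
G ≈ H = ∀ u v → adj G u v ≡ adj H u v

infixl 6 _⊕_

_⊕_ : ∀ {n} → Graph n → Graph n → Graph n
adj    (G ⊕ H) u v = adj G u v xor adj H u v
symm   (G ⊕ H) u v = cong₂ _xor_ (symm G u v) (symm H u v)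
irrefl (G ⊕ H) v   = cong₂ _xor_ (irrefl G v) (irrefl H v)

infix 4 _⊑_

-- H ⊑ G : G has a (not necessarily induced) subgraph isomorphic to H.
_⊑_ : ∀ {m n} → Graph m → Graph n → Set
_⊑_ {m} {n} H G =
  Σ (Fin m → Fin n) λ f → Injective _≡_ _≡_ f × (∀ u v → Adj H u v → Adj G (f u) (f v))

record Connected {n : ℕ} (G : Graph n) : Set where
  field
    nonempty : Fin n
    walk     : ∀ u v → Star (Adj G) u v

record IsBipartition {n : ℕ} (G : Graph n) (A B : Subset n) : Set where
  field
    cover    : A ∪ B ≡ ⊤
    disjoint : A ∩ B ≡ ⊥
    crossing : ∀ u v → Adj G u v → (u ∈ A × v ∈ B) ⊎ (u ∈ B × v ∈ A)

record IsL (r : ℕ) {m : ℕ} (L : Graph m) (A B : Subset m) : Set where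
  field
    connected     : Connected L
    bipartition   : IsBipartition L A B
    boundedDegree : ∀ a → a ∈ A → ∣ neighbours L a ∩ B ∣ ≤ r

------------------------------------------------------------------------
-- M_L(n)

IsFamily : ∀ {m} → Graph m → ∀ {n k} → (Fin k → Graph n) → Set
IsFamily L 𝒢 = ∀ i j → i ≢ j → ¬ (𝒢 i ≈ 𝒢 j) × L ⊑ 𝒢 i ⊕ 𝒢 j

HasFamily : ∀ {m} → Graph m → (n k : ℕ) → Set
HasFamily L n k = Σ (Fin k → Graph n) (IsFamily L)

IsMaximum : (ℕ → Set) → ℕ → Set
IsMaximum P k = P k × (∀ j → P j → j ≤ k)

maximum : {P : ℕ → Set} → (∀ k → Dec (P k)) → P 0 →
          ∀ b → (∀ k → P k → k ≤ b) → ∃ (IsMaximum P)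
maximum P? p₀ zero    bnd = 0 , p₀ , bnd
maximum P? p₀ (suc b) bnd with P? (suc b)
... | yes p = suc b , p , bnd
... | no ¬p = maximum P? p₀ b λ k pk → ℕ.≤-pred
  (ℕ.≤∧≢⇒< (bnd k pk) λ { refl → ¬p pk })

bit : Bool → Fin 2
bit b = if b then suc zero else zero

unbit : Fin 2 → Bool
unbit zero    = false
unbit (suc _) = true

unbit-bit : ∀ b → unbit (bit b) ≡ b
unbit-bit false = refl
unbit-bit true  = refl

encode : ∀ {n} → Graph n → Fin ((2 ^ n) ^ n)
encode G = funToFin λ u → funToFin λ v → bit (adj G u v)

matrix : ∀ {n} → Fin ((2 ^ n) ^ n) → Fin n → Fin n → Bool
matrix {n} c u v = unbit (finToFun {2} {n} (finToFun {2 ^ n} {n} c u) v)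

matrix-encode : ∀ {n} (G : Graph n) u v → matrix (encode G) u v ≡ adj G u v
matrix-encode {n} G u v = begin
  unbit (finToFun {2} {n} (finToFun {2 ^ n} {n} (encode G) u) v)
    ≡⟨ cong (λ c → unbit (finToFun {2} {n} c v)) (finToFun-funToFin {n} _ u) ⟩
  unbit (finToFun {2} {n} (funToFin λ w → bit (adj G u w)) v)
    ≡⟨ cong unbit (finToFun-funToFin {n} _ v) ⟩
  unbit (bit (adj G u v))
    ≡⟨ unbit-bit _ ⟩
  adj G u v ∎
  where open ≡-Reasoning

encode-injective : ∀ {n} (G H : Graph n) → encode G ≡ encode H → G ≈ H
encode-injective G H eq u v = begin
  adj G u v               ≡⟨ matrix-encode G u v ⟨
  matrix (encode G) u v   ≡⟨ cong (λ c → matrix c u v) eq ⟩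
  matrix (encode H) u v   ≡⟨ matrix-encode H u v ⟩
  adj H u v               ∎
  where open ≡-Reasoning

decode : ∀ {n} → Fin ((2 ^ n) ^ n) → Graph n
adj    (decode c) u v = (matrix c u v ∧ matrix c v u) ∧ not (does (u Fin.≟ v))
symm   (decode c) u v = cong₂ _∧_ (∧-comm (matrix c u v) _) (cong not lemma)
  where
  lemma : does (u Fin.≟ v) ≡ does (v Fin.≟ u)
  lemma with u Fin.≟ v
  ... | yes eq = sym (dec-true (v Fin.≟ u) (sym eq))
  ... | no neq = sym (dec-false (v Fin.≟ u) (neq ∘ sym))
irrefl (decode c) v
  rewrite dec-true (v Fin.≟ v) refl = ∧-zeroʳ (matrix c v v ∧ matrix c v v)

decode-encode : ∀ {n} (G : Graph n) → decode (encode G) ≈ G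
decode-encode G u v
  rewrite matrix-encode G u v | matrix-encode G v u | symm G v u | ∧-idem (adj G u v)
  with u Fin.≟ v
... | no _     = ∧-identityʳ _
... | yes refl = trans (∧-zeroʳ _) (sym (irrefl G u))

⊑-dec : ∀ {m n} (H : Graph m) (G : Graph n) → Dec (H ⊑ G)
⊑-dec {m} {n} H G = map′ to from (any? λ c → Q? (finToFun {n} {m} c))
  where
  Q : (Fin m → Fin n) → Set
  Q f = (∀ u v → f u ≡ f v → u ≡ v) × (∀ u v → Adj H u v → Adj G (f u) (f v))

  Q? : ∀ f → Dec (Q f)
  Q? f = (all? λ u → all? λ v → (f u Fin.≟ f v) →-dec (u Fin.≟ v))
    ×-dec (all? λ u → all? λ v → T? (adj H u v) →-dec T? (adj G (f u) (f v)))

  to : ∃ (Q ∘ finToFun {n} {m}) → H ⊑ G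
  to (c , inj , hom) = finToFun c , (λ {u} {v} → inj u v) , hom

  from : H ⊑ G → ∃ (Q ∘ finToFun {n} {m})
  from (f , inj , hom) = funToFin f
    , (λ u v eq → inj (trans (sym (e u)) (trans eq (e v))))
    , (λ u v a → subst₂ (Adj G) (sym (e u)) (sym (e v)) (hom u v a))
    where e = finToFun-funToFin f

HasFamily-dec : ∀ {m} (L : Graph m) n k → Dec (HasFamily L n k)
HasFamily-dec L n k = map′ to from (any? λ c → Q? (decode ∘ finToFun {(2 ^ n) ^ n} {k} c))
  where
  Q? : (𝒢 : Fin k → Graph n) → Dec (IsFamily L 𝒢)
  Q? 𝒢 = all? λ i → all? λ j → ¬? (i Fin.≟ j) →-dec
    (¬? (all? λ u → all? λ v → adj (𝒢 i) u v Bool.≟ adj (𝒢 j) u v)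
      ×-dec ⊑-dec L (𝒢 i ⊕ 𝒢 j))

  to : ∃ (λ c → IsFamily L (decode ∘ finToFun {(2 ^ n) ^ n} {k} c)) → HasFamily L n k
  to (c , fam) = decode ∘ finToFun c , fam

  from : HasFamily L n k → ∃ (λ c → IsFamily L (decode ∘ finToFun {(2 ^ n) ^ n} {k} c))
  from (𝒢 , fam) = funToFin (encode ∘ 𝒢) , λ i j i≢j →
    let distinct , f , inj , hom = fam i j i≢j in
      (λ eq → distinct λ u v → trans (sym (e i u v)) (trans (eq u v) (e j u v)))
    , f , inj
    , λ u v a → subst T (sym (cong₂ _xor_ (e i _ _) (e j _ _))) (hom u v a)
    where
    e : ∀ i → decode (finToFun (funToFin (encode ∘ 𝒢)) i) ≈ 𝒢 i
    e i u v = trans (cong (λ c → adj (decode c) u v) (finToFun-funToFin (encode ∘ 𝒢) i))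
                    (decode-encode (𝒢 i) u v)

HasFamily-bound : ∀ {m} (L : Graph m) n k → HasFamily L n k → k ≤ (2 ^ n) ^ n
HasFamily-bound L n k (𝒢 , fam) = injective⇒≤ {f = encode ∘ 𝒢} λ {i} {j} eq →
  decidable-stable (i Fin.≟ j) λ i≢j →
    proj₁ (fam i j i≢j) (encode-injective (𝒢 i) (𝒢 j) eq)

-- Abstract so that M L n stays folded; M-isMaximum characterises it.
abstract
  maximumFamily : ∀ {m} (L : Graph m) n → ∃ (IsMaximum (HasFamily L n))
  maximumFamily L n = maximum (HasFamily-dec L n) ((λ ()) , λ ()) _ (HasFamily-bound L n)

M : ∀ {m} → Graph m → ℕ → ℕ
M L n = proj₁ (maximumFamily L n)

M-isMaximum : ∀ {m} (L : Graph m) n → IsMaximum (HasFamily L n) (M L n)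
M-isMaximum L n = proj₂ (maximumFamily L n)

instance
  M-nonZero : ∀ {m} {L : Graph m} {n} → NonZero (M L n)
  M-nonZero {L = L} {n} = ℕ.>-nonZero (proj₂ (M-isMaximum L n) 1 (singleton , trivial))
    where
    singleton : Fin 1 → Graph n
    adj    (singleton _) _ _ = false
    symm   (singleton _) _ _ = refl
    irrefl (singleton _) _   = refl

    trivial : IsFamily L singleton
    trivial zero zero 0≢0 = contradiction refl 0≢0

------------------------------------------------------------------------
-- Real numbers as two-sided Dedekind cuts of the rationals

record ℝ : Set₁ where
  field
    Lower Upper   : ℚᵘ → Set
    lower-inhab   : ∃ Lower
    upper-inhab   : ∃ Upper
    lower-rounded : ∀ q → Lower q ⇔ (∃[ r ] q ℚ.< r × Lower r)
    upper-rounded : ∀ q → Upper q ⇔ (∃[ r ] r ℚ.< q × Upper r)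
    disjoint      : ∀ q → Lower q → ¬ Upper q
    located       : ∀ q r → q ℚ.< r → Lower q ⊎ Upper r

open ℝ public using (Lower; Upper)

infix 4 _<ᴿ_ _ᴿ<_

_<ᴿ_ : ℚᵘ → ℝ → Set
q <ᴿ x = Lower x q

_ᴿ<_ : ℝ → ℚᵘ → Set
x ᴿ< q = Upper x q

module _ (x : ℝ) where
  open ℝ x hiding (Lower; Upper)

  lower-resp : ∀ {p q} → p ℚ.≃ q → Lower x p → Lower x q
  lower-resp p≃q lp with r , p<r , lr ← Equivalence.to (lower-rounded _) lp =
    Equivalence.from (lower-rounded _) (r , ℚ.<-respˡ-≃ p≃q p<r , lr)

  upper-resp : ∀ {p q} → p ℚ.≃ q → Upper x p → Upper x q
  upper-resp p≃q up with r , r<p , ur ← Equivalence.to (upper-rounded _) up =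
    Equivalence.from (upper-rounded _) (r , ℚ.<-respʳ-≃ p≃q r<p , ur)

fromℚ : ℚᵘ → ℝ
fromℚ p = record
  { Lower         = ℚ._< p
  ; Upper         = p ℚ.<_
  ; lower-inhab   = p ℚ.- 1ℚᵘ , ℚ.<-respʳ-≃ (ℚ.+-identityʳ p) (ℚ.+-monoʳ-< p (ℚ.*<* ℤ.-<+))
  ; upper-inhab   = p ℚ.+ 1ℚᵘ , ℚ.<-respˡ-≃ (ℚ.+-identityʳ p) (ℚ.+-monoʳ-< p (ℚ.*<* (ℤ.+<+ z<s)))
  ; lower-rounded = λ q → mk⇔ ℚ.<-dense (λ (_ , q<r , r<p) → ℚ.<-trans q<r r<p)
  ; upper-rounded = λ q → mk⇔ (λ p<q → let r , p<r , r<q = ℚ.<-dense p<q in r , r<q , p<r)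
                              (λ (_ , r<q , p<r) → ℚ.<-trans p<r r<q)
  ; disjoint      = λ q → ℚ.<-asym
  ; located       = λ q r q<r → loc q r q<r
  }
  where
  loc : ∀ q r → q ℚ.< r → q ℚ.< p ⊎ p ℚ.< r
  loc q r q<r with q ℚ.<? p
  ... | yes q<p = inj₁ q<p
  ... | no q≮p  = inj₂ (ℚ.≤-<-trans (ℚ.≮⇒≥ q≮p) q<r)

infixl 6 _-ᴿ_

_-ᴿ_ : ℚᵘ → ℝ → ℝ
p -ᴿ x = record
  { Lower         = λ q → Upper x (p ℚ.- q)
  ; Upper         = λ q → Lower x (p ℚ.- q)
  ; lower-inhab   = let q , u = upper-inhab in p ℚ.- q , upper-resp x (invol q) u
  ; upper-inhab   = let q , l = lower-inhab in p ℚ.- q , lower-resp x (invol q) l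
  ; lower-rounded = λ q → mk⇔
      (λ u → let r , r< , ur = Equivalence.to (upper-rounded _) u in
        p ℚ.- r , ℚ.<-respˡ-≃ (ℚ.≃-sym (invol q)) (anti r<) , upper-resp x (invol r) ur)
      (λ (r , q<r , ur) → Equivalence.from (upper-rounded _) (p ℚ.- r , anti q<r , ur))
  ; upper-rounded = λ q → mk⇔
      (λ l → let r , <r , lr = Equivalence.to (lower-rounded _) l in
        p ℚ.- r , ℚ.<-respʳ-≃ (ℚ.≃-sym (invol q)) (anti <r) , lower-resp x (invol r) lr)
      (λ (r , r<q , lr) → Equivalence.from (lower-rounded _) (p ℚ.- r , anti r<q , lr))
  ; disjoint      = λ q u l → disjoint _ l u
  ; located       = λ q r q<r → swap (located _ _ (anti q<r))
  }
  where
  open ℝ x hiding (Lower; Upper)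

  invol : ∀ q → q ℚ.≃ p ℚ.- (p ℚ.- q)
  invol q = begin
    q                       ≈⟨ ℚ.+-identityˡ q ⟨
    0ℚᵘ ℚ.+ q               ≈⟨ ℚ.+-congˡ q (ℚ.+-inverseʳ p) ⟨
    (p ℚ.- p) ℚ.+ q         ≈⟨ ℚ.+-assoc p (ℚ.- p) q ⟩
    p ℚ.+ (ℚ.- p ℚ.+ q)     ≈⟨ ℚ.+-congʳ p (ℚ.+-congʳ (ℚ.- p) (ℚ.neg-involutive q)) ⟨
    p ℚ.+ (ℚ.- p ℚ.- ℚ.- q) ≡⟨ cong (p ℚ.+_) (ℚ.neg-distrib-+ p (ℚ.- q)) ⟨
    p ℚ.- (p ℚ.- q)         ∎
    where open ℚ.≃-Reasoning

  anti : ∀ {q r} → q ℚ.< r → p ℚ.- r ℚ.< p ℚ.- q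
  anti q<r = ℚ.+-monoʳ-< p (ℚ.neg-mono-< q<r)

  swap : ∀ {a b : Set} → a ⊎ b → b ⊎ a
  swap (inj₁ a) = inj₂ a
  swap (inj₂ b) = inj₁ b

infixl 7 _/ᴿ_

-- Quotient of a real by a natural number; as a convention x / 0 = 0.
_/ᴿ_ : ℝ → ℕ → ℝ
x /ᴿ zero      = fromℚ 0ℚᵘ
x /ᴿ d@(suc _) = record
  { Lower         = λ q → Lower x (q ℚ.* D)
  ; Upper         = λ q → Upper x (q ℚ.* D)
  ; lower-inhab   = let q , l = lower-inhab in q ℚ.* D⁻¹ , lower-resp x (cancel q) l
  ; upper-inhab   = let q , u = upper-inhab in q ℚ.* D⁻¹ , upper-resp x (cancel q) u
  ; lower-rounded = λ q → mk⇔
      (λ l → let r , <r , lr = Equivalence.to (lower-rounded _) l in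
        r ℚ.* D⁻¹
        , ℚ.*-cancelʳ-<-nonNeg D (ℚ.<-respʳ-≃ (cancel r) <r)
        , lower-resp x (cancel r) lr)
      (λ (r , q<r , lr) →
        Equivalence.from (lower-rounded _) (r ℚ.* D , ℚ.*-monoˡ-<-pos D q<r , lr))
  ; upper-rounded = λ q → mk⇔
      (λ u → let r , r< , ur = Equivalence.to (upper-rounded _) u in
        r ℚ.* D⁻¹
        , ℚ.*-cancelʳ-<-nonNeg D (ℚ.<-respˡ-≃ (cancel r) r<)
        , upper-resp x (cancel r) ur)
      (λ (r , r<q , ur) →
        Equivalence.from (upper-rounded _) (r ℚ.* D , ℚ.*-monoˡ-<-pos D r<q , ur))
  ; disjoint      = λ q → disjoint _
  ; located       = λ q r q<r → located _ _ (ℚ.*-monoˡ-<-pos D q<r)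
  }
  where
  open ℝ x hiding (Lower; Upper)

  D D⁻¹ : ℚᵘ
  D   = + d ℚ./ 1
  D⁻¹ = ℚ.1/ D

  cancel : ∀ q → q ℚ.≃ q ℚ.* D⁻¹ ℚ.* D
  cancel q = begin
    q                   ≈⟨ ℚ.*-identityʳ q ⟨
    q ℚ.* 1ℚᵘ           ≈⟨ ℚ.*-congˡ {q} (ℚ.*-inverseˡ D) ⟨
    q ℚ.* (D⁻¹ ℚ.* D)   ≈⟨ ℚ.*-assoc q D⁻¹ D ⟨
    q ℚ.* D⁻¹ ℚ.* D     ∎
    where open ℚ.≃-Reasoning

infix 4 _⟶_

-- |x n - ℓ| < δ, unfolded as ℓ - δ < x n < ℓ + δ; rational δ suffice because
-- every positive real lies above a positive rational.
_⟶_ : (ℕ → ℝ) → ℚᵘ → Set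
x ⟶ ℓ = ∀ δ → 0ℚᵘ ℚ.< δ →
  ∃[ N ] ∀ n → N ≤ n → (ℓ ℚ.- δ <ᴿ x n) × (x n ᴿ< ℓ ℚ.+ δ)

------------------------------------------------------------------------
-- Rational powers

-- For s = i / b the rational power n ^ s is the b-th root of n ^ i, and
-- n ^ i = n ^ (i ⁺) / n ^ (i ⁻).  Comparisons with n ^ s are stated after
-- clearing this denominator and taking b-th powers.

infix 9 _⁺ _⁻

_⁺ _⁻ : ℤ → ℕ
(+ a)    ⁺ = a
-[1+ a ] ⁺ = 0
(+ a)    ⁻ = 0
-[1+ a ] ⁻ = suc a

-- 2 ^ s < k
Pow2<_ : ℕ → ℚᵘ → Set
(Pow2< k) s = 2 ^ (↥ s) ⁺ < k ^ ↧ₙ s * 2 ^ (↥ s) ⁻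

-- k < 2 ^ s
_<Pow2 : ℕ → ℚᵘ → Set
(k <Pow2) s = k ^ ↧ₙ s * 2 ^ (↥ s) ⁻ < 2 ^ (↥ s) ⁺

-- f ≤ c · n ^ s
_≤_·_^ℚ_ : ℕ → ℕ → ℕ → ℚᵘ → Set
f ≤ c · n ^ℚ s = f ^ ↧ₙ s * n ^ (↥ s) ⁻ ≤ c ^ ↧ₙ s * n ^ (↥ s) ⁺

-- f(n) = O(n ^ x).  For n ≥ 1 the real power n ^ x is the infimum of the
-- n ^ s over rationals s > x, hence the quantification over the upper cut.
-- The constant c may be taken to be a natural number.
_=O[n^_] : (ℕ → ℕ) → ℝ → Set
f =O[n^ x ] = ∃[ c ] ∃[ N ] ∀ n → N ≤ n → ∀ s → x ᴿ< s → f n ≤ c · n ^ℚ s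

------------------------------------------------------------------------
-- The binary logarithm of a positive natural number

⊖-⁺⁻ : ∀ p q → (p ⊖ q) ⁺ + q ≡ p + (p ⊖ q) ⁻
⊖-⁺⁻ zero    zero    = refl
⊖-⁺⁻ zero    (suc q) = refl
⊖-⁺⁻ (suc p) zero    = refl
⊖-⁺⁻ (suc p) (suc q) rewrite ℤ.[1+m]⊖[1+n]≡m⊖n p q =
  trans (ℕ.+-suc _ q) (cong suc (⊖-⁺⁻ p q))

<⇒⁺⁻ : ∀ {s r} → s ℚ.< r →
  (↥ s) ⁺ * ↧ₙ r + (↥ r) ⁻ * ↧ₙ s < (↥ r) ⁺ * ↧ₙ s + (↥ s) ⁻ * ↧ₙ r
<⇒⁺⁻ {mkℚᵘ (+ a) b} {mkℚᵘ (+ c) d} (ℚ.*<* lt)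
  rewrite ℕ.+-identityʳ (a * suc d) | ℕ.+-identityʳ (c * suc b)
  = ℤ.drop‿+<+ (subst₂ ℤ._<_ (ℤ.+◃n≡+n _) (ℤ.+◃n≡+n _) lt)
<⇒⁺⁻ {mkℚᵘ (+ a) b} {mkℚᵘ -[1+ c ] d} (ℚ.*<* lt)
  with () ← subst (ℤ._< _) (ℤ.+◃n≡+n (a * suc d)) lt
<⇒⁺⁻ {mkℚᵘ -[1+ a ] b} {mkℚᵘ (+ c) d} _ = ℕ.m≤n⇒m≤o+n (c * suc b) z<s
<⇒⁺⁻ {mkℚᵘ -[1+ a ] b} {mkℚᵘ -[1+ c ] d} (ℚ.*<* (ℤ.-<- lt)) = s≤s lt

⁺⁻⇒< : ∀ {s r} →
  (↥ s) ⁺ * ↧ₙ r + (↥ r) ⁻ * ↧ₙ s < (↥ r) ⁺ * ↧ₙ s + (↥ s) ⁻ * ↧ₙ r → s ℚ.< r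
⁺⁻⇒< {mkℚᵘ (+ a) b} {mkℚᵘ (+ c) d} lt
  rewrite ℕ.+-identityʳ (a * suc d) | ℕ.+-identityʳ (c * suc b)
  = ℚ.*<* (subst₂ ℤ._<_ (sym (ℤ.+◃n≡+n _)) (sym (ℤ.+◃n≡+n _)) (ℤ.+<+ lt))
⁺⁻⇒< {mkℚᵘ (+ a) b} {mkℚᵘ -[1+ c ] d} ()
⁺⁻⇒< {mkℚᵘ -[1+ a ] b} {mkℚᵘ (+ c) d} _ =
  ℚ.*<* (subst (_ ℤ.<_) (sym (ℤ.+◃n≡+n (c * suc b))) ℤ.-<+)
⁺⁻⇒< {mkℚᵘ -[1+ a ] b} {mkℚᵘ -[1+ c ] d} (s≤s lt) = ℚ.*<* (ℤ.-<- lt)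

^-distribʳ-* : ∀ m n t → (m * n) ^ t ≡ m ^ t * n ^ t
^-distribʳ-* m n zero    = refl
^-distribʳ-* m n (suc t) = trans (cong (m * n *_) (^-distribʳ-* m n t))
  (solve 4 (λ m n x y → m :* n :* (x :* y) := m :* x :* (n :* y)) refl m n (m ^ t) (n ^ t))
  where open +-*-Solver

bernoulli : ∀ y t → y ^ t * (y + t) ≤ y * suc y ^ t
bernoulli y zero    = ℕ.≤-reflexive
  (solve 1 (λ y → con 1 :* (y :+ con 0) := y :* con 1) refl y)
  where open +-*-Solver
bernoulli y (suc t) = begin
  y * y ^ t * (y + suc t)         ≤⟨ ℕ.m≤m+n _ (y ^ t * t) ⟩
  y * y ^ t * (y + suc t) + y ^ t * t
    ≡⟨ solve 3 (λ y t p → y :* p :* (y :+ (con 1 :+ t)) :+ p :* t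
                        := (con 1 :+ y) :* (p :* (y :+ t))) refl y t (y ^ t) ⟩
  suc y * (y ^ t * (y + t))       ≤⟨ ℕ.*-monoʳ-≤ (suc y) (bernoulli y t) ⟩
  suc y * (y * suc y ^ t)
    ≡⟨ solve 2 (λ y p → (con 1 :+ y) :* (y :* p) := y :* ((con 1 :+ y) :* p)) refl y (suc y ^ t) ⟩
  y * (suc y * suc y ^ t)         ∎
  where
  open ℕ.≤-Reasoning
  open +-*-Solver

double-< : ∀ y x → 0 < y → y < x → 2 * y ^ suc y < x ^ suc y
double-< y@(suc _) x _ y<x = ℕ.*-cancelˡ-< y _ _ (begin-strict
  y * (2 * p)          <⟨ ℕ.m<m+n _ (ℕ.m^n>0 y (suc y)) ⟩
  y * (2 * p) + p      ≡⟨ solve 2 (λ y p → y :* (con 2 :* p) :+ p := p :* (y :+ (con 1 :+ y))) refl y p ⟩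
  p * (y + suc y)      ≤⟨ bernoulli y (suc y) ⟩
  y * suc y ^ suc y    ≤⟨ ℕ.*-monoʳ-≤ y (ℕ.^-monoˡ-≤ (suc y) y<x) ⟩
  y * x ^ suc y        ∎)
  where
  open ℕ.≤-Reasoning
  open +-*-Solver
  p = y ^ suc y

^-cancelˡ-< : ∀ {m n} b → m ^ b < n ^ b → m < n
^-cancelˡ-< b lt = ℕ.≰⇒> λ n≤m → ℕ.<⇒≱ lt (ℕ.^-monoˡ-≤ b n≤m)

n<2^n : ∀ n → n < 2 ^ n
n<2^n zero    = z<s
n<2^n (suc n) = begin-strict
  suc n            <⟨ s≤s (n<2^n n) ⟩
  1 + 2 ^ n        ≤⟨ ℕ.+-monoˡ-≤ (2 ^ n) (ℕ.m^n>0 2 n) ⟩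
  2 ^ n + 2 ^ n    ≡⟨ cong (2 ^ n ℕ.+_) (ℕ.+-identityʳ _) ⟨
  2 ^ suc n        ∎
  where open ℕ.≤-Reasoning

shift-eq : ∀ {P Q r r′} → r + Q ≡ P + r′ → 2 ^ r * 2 ^ Q ≡ 2 ^ P * 2 ^ r′
shift-eq {P} {Q} {r} {r′} eq =
  trans (sym (ℕ.^-distribˡ-+-* 2 r Q)) (trans (cong (2 ^_) eq) (ℕ.^-distribˡ-+-* 2 P r′))

shift-lower : ∀ {P Q r r′} K → r + Q ≡ P + r′ → 2 ^ P < K * 2 ^ Q → 2 ^ r < K * 2 ^ r′
shift-lower {P} {Q} {r} {r′} K eq lt = ℕ.*-cancelʳ-< (2 ^ Q) _ _ (begin-strict
  2 ^ r * 2 ^ Q          ≡⟨ shift-eq {P} {Q} {r} eq ⟩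
  2 ^ P * 2 ^ r′         <⟨ ℕ.*-monoˡ-< (2 ^ r′) {{ℕ.m^n≢0 2 r′}} lt ⟩
  K * 2 ^ Q * 2 ^ r′
    ≡⟨ solve 3 (λ k q r → k :* q :* r := k :* r :* q) refl K (2 ^ Q) (2 ^ r′) ⟩
  K * 2 ^ r′ * 2 ^ Q     ∎)
  where
  open ℕ.≤-Reasoning
  open +-*-Solver

shift-upper : ∀ {P Q r r′} K → r + Q ≡ P + r′ → K * 2 ^ Q < 2 ^ P → K * 2 ^ r′ < 2 ^ r
shift-upper {P} {Q} {r} {r′} K eq lt = ℕ.*-cancelʳ-< (2 ^ Q) _ _ (begin-strict
  K * 2 ^ r′ * 2 ^ Q
    ≡⟨ solve 3 (λ k q r → k :* q :* r := k :* r :* q) refl K (2 ^ r′) (2 ^ Q) ⟩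
  K * 2 ^ Q * 2 ^ r′     <⟨ ℕ.*-monoˡ-< (2 ^ r′) {{ℕ.m^n≢0 2 r′}} lt ⟩
  2 ^ P * 2 ^ r′         ≡⟨ shift-eq {P} {Q} {r} eq ⟨
  2 ^ r * 2 ^ Q          ∎)
  where
  open ℕ.≤-Reasoning
  open +-*-Solver

module _ (k : ℕ) where

  ¬lower⇒upper : ∀ {s r} → s ℚ.< r → ¬ (Pow2< k) s → (k <Pow2) r
  ¬lower⇒upper {s} {r} s<r ¬l = ^-cancelˡ-< b (ℕ.*-cancelʳ-< (2 ^ (i⁻ * d)) _ _ (begin-strict
    (k ^ d * 2 ^ j⁻) ^ b * 2 ^ (i⁻ * d)
      ≡⟨ cong (_* 2 ^ (i⁻ * d)) (pow d j⁻ b) ⟩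
    k ^ (d * b) * 2 ^ (j⁻ * b) * 2 ^ (i⁻ * d)
      ≡⟨ solve 3 (λ x y z → x :* y :* z := x :* z :* y) refl (k ^ (d * b)) (2 ^ (j⁻ * b)) (2 ^ (i⁻ * d)) ⟩
    k ^ (d * b) * 2 ^ (i⁻ * d) * 2 ^ (j⁻ * b)
      ≡⟨ cong (λ e → k ^ e * 2 ^ (i⁻ * d) * 2 ^ (j⁻ * b)) (ℕ.*-comm d b) ⟩
    k ^ (b * d) * 2 ^ (i⁻ * d) * 2 ^ (j⁻ * b)
      ≡⟨ cong (_* 2 ^ (j⁻ * b)) (pow b i⁻ d) ⟨
    (k ^ b * 2 ^ i⁻) ^ d * 2 ^ (j⁻ * b)
      ≤⟨ ℕ.*-monoˡ-≤ (2 ^ (j⁻ * b)) (ℕ.^-monoˡ-≤ d (ℕ.≮⇒≥ ¬l)) ⟩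
    (2 ^ i⁺) ^ d * 2 ^ (j⁻ * b)
      ≡⟨ cong (_* 2 ^ (j⁻ * b)) (ℕ.^-*-assoc 2 i⁺ d) ⟩
    2 ^ (i⁺ * d) * 2 ^ (j⁻ * b)
      ≡⟨ ℕ.^-distribˡ-+-* 2 (i⁺ * d) (j⁻ * b) ⟨
    2 ^ (i⁺ * d + j⁻ * b)
      <⟨ ℕ.^-monoʳ-< 2 (s≤s (s≤s z≤n)) (<⇒⁺⁻ s<r) ⟩
    2 ^ (j⁺ * b + i⁻ * d)
      ≡⟨ ℕ.^-distribˡ-+-* 2 (j⁺ * b) (i⁻ * d) ⟩
    2 ^ (j⁺ * b) * 2 ^ (i⁻ * d)
      ≡⟨ cong (_* 2 ^ (i⁻ * d)) (ℕ.^-*-assoc 2 j⁺ b) ⟨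
    (2 ^ j⁺) ^ b * 2 ^ (i⁻ * d) ∎))
    where
    open ℕ.≤-Reasoning
    open +-*-Solver
    b = ↧ₙ s
    d = ↧ₙ r
    i⁺ = (↥ s) ⁺
    i⁻ = (↥ s) ⁻
    j⁺ = (↥ r) ⁺
    j⁻ = (↥ r) ⁻
    pow : ∀ x y z → (k ^ x * 2 ^ y) ^ z ≡ k ^ (x * z) * 2 ^ (y * z)
    pow x y z = trans (^-distribʳ-* (k ^ x) (2 ^ y) z)
      (cong₂ _*_ (ℕ.^-*-assoc k x z) (ℕ.^-*-assoc 2 y z))

  lower? : ∀ s → Dec ((Pow2< k) s)
  lower? s = _ ℕ.<? _

  lower-closed : ∀ {s r} → s ℚ.< r → (Pow2< k) r → (Pow2< k) s
  lower-closed {s} {r} s<r lr = decidable-stable (lower? s) λ ¬l →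
    ℕ.<-asym lr (¬lower⇒upper {s} {r} s<r ¬l)

  upper-closed : ∀ {s r} → s ℚ.< r → (k <Pow2) s → (k <Pow2) r
  upper-closed {s} {r} s<r us = ¬lower⇒upper {s} {r} s<r (ℕ.<-asym us)

  power : ∀ s t → (k ^ ↧ₙ s * 2 ^ (↥ s) ⁻) ^ t ≡ k ^ (t * ↧ₙ s) * 2 ^ (t * (↥ s) ⁻)
  power s t = trans (^-distribʳ-* (k ^ ↧ₙ s) _ t) (cong₂ _*_
    (trans (ℕ.^-*-assoc k (↧ₙ s) t) (cong (k ^_) (ℕ.*-comm (↧ₙ s) t)))
    (trans (ℕ.^-*-assoc 2 ((↥ s) ⁻) t) (cong (2 ^_) (ℕ.*-comm ((↥ s) ⁻) t))))

  lower-open : ∀ s → (Pow2< k) s → ∃[ r ] s ℚ.< r × (Pow2< k) r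
  lower-open s@(mkℚᵘ i b-1) l = r , ⁺⁻⇒< {s} {r} order , shift-lower {P} {Q} {(P ⊖ Q) ⁺} {(P ⊖ Q) ⁻} (k ^ (t * b)) (⊖-⁺⁻ P Q) (begin-strict
    2 * 2 ^ (t * i ⁺)            ≡⟨ cong (λ e → 2 * 2 ^ e) (ℕ.*-comm t (i ⁺)) ⟩
    2 * 2 ^ (i ⁺ * t)            ≡⟨ cong (2 *_) (ℕ.^-*-assoc 2 (i ⁺) t) ⟨
    2 * y ^ t                    <⟨ double-< y x (ℕ.m^n>0 2 (i ⁺)) l ⟩
    x ^ t                        ≡⟨ power s t ⟩
    k ^ (t * b) * 2 ^ (t * i ⁻)  ∎)
    where
    open ℕ.≤-Reasoning
    b = suc b-1
    y = 2 ^ i ⁺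
    x = k ^ b * 2 ^ i ⁻
    t = suc y
    P = suc (t * i ⁺)
    Q = t * i ⁻
    r = mkℚᵘ (P ⊖ Q) (b-1 + y * b)
    order : i ⁺ * (t * b) + (P ⊖ Q) ⁻ * b < (P ⊖ Q) ⁺ * b + i ⁻ * (t * b)
    order = begin-strict
      i ⁺ * (t * b) + (P ⊖ Q) ⁻ * b   ≡⟨ solve 4 (λ i t b m → i :* (t :* b) :+ m :* b := (t :* i :+ m) :* b) refl (i ⁺) t b ((P ⊖ Q) ⁻) ⟩
      (t * i ⁺ + (P ⊖ Q) ⁻) * b       <⟨ ℕ.*-monoˡ-< b (ℕ.n<1+n (t * i ⁺ + (P ⊖ Q) ⁻)) ⟩
      (P + (P ⊖ Q) ⁻) * b             ≡⟨ cong (_* b) (⊖-⁺⁻ P Q) ⟨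
      ((P ⊖ Q) ⁺ + Q) * b             ≡⟨ solve 4 (λ m t i b → (m :+ t :* i) :* b := m :* b :+ i :* (t :* b)) refl ((P ⊖ Q) ⁺) t (i ⁻) b ⟩
      (P ⊖ Q) ⁺ * b + i ⁻ * (t * b)   ∎
      where open +-*-Solver

  upper-open : .{{NonZero k}} → ∀ s → (k <Pow2) s → ∃[ r ] r ℚ.< s × (k <Pow2) r
  upper-open s@(mkℚᵘ i b-1) u = r , ⁺⁻⇒< {r} {s} order , shift-upper {P} {Q} {(P ⊖ Q) ⁺} {(P ⊖ Q) ⁻} (k ^ (t * b)) (⊖-⁺⁻ P Q) (begin-strict
    k ^ (t * b) * (2 * 2 ^ (t * i ⁻))
      ≡⟨ solve 2 (λ p q → p :* (con 2 :* q) := con 2 :* (p :* q)) refl (k ^ (t * b)) (2 ^ (t * i ⁻)) ⟩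
    2 * (k ^ (t * b) * 2 ^ (t * i ⁻))  ≡⟨ cong (2 *_) (power s t) ⟨
    2 * x ^ t                          <⟨ double-< x y (ℕ.*-mono-≤ (ℕ.m^n>0 k b) (ℕ.m^n>0 2 (i ⁻))) u ⟩
    y ^ t                              ≡⟨ ℕ.^-*-assoc 2 (i ⁺) t ⟩
    2 ^ (i ⁺ * t)                      ≡⟨ cong (2 ^_) (ℕ.*-comm (i ⁺) t) ⟩
    2 ^ (t * i ⁺)                      ∎)
    where
    open ℕ.≤-Reasoning
    open +-*-Solver
    b = suc b-1
    y = 2 ^ i ⁺
    x = k ^ b * 2 ^ i ⁻
    t = suc x
    P = t * i ⁺
    Q = suc (t * i ⁻)
    r = mkℚᵘ (P ⊖ Q) (b-1 + x * b)
    order : (P ⊖ Q) ⁺ * b + i ⁻ * (t * b) < i ⁺ * (t * b) + (P ⊖ Q) ⁻ * b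
    order = begin-strict
      (P ⊖ Q) ⁺ * b + i ⁻ * (t * b)   ≡⟨ solve 4 (λ m t i b → m :* b :+ i :* (t :* b) := (m :+ t :* i) :* b) refl ((P ⊖ Q) ⁺) t (i ⁻) b ⟩
      ((P ⊖ Q) ⁺ + t * i ⁻) * b       <⟨ ℕ.*-monoˡ-< b (ℕ.+-monoʳ-< ((P ⊖ Q) ⁺) (ℕ.n<1+n (t * i ⁻))) ⟩
      ((P ⊖ Q) ⁺ + Q) * b             ≡⟨ cong (_* b) (⊖-⁺⁻ P Q) ⟩
      (P + (P ⊖ Q) ⁻) * b             ≡⟨ solve 4 (λ t i m b → (t :* i :+ m) :* b := i :* (t :* b) :+ m :* b) refl t (i ⁺) ((P ⊖ Q) ⁻) b ⟩
      i ⁺ * (t * b) + (P ⊖ Q) ⁻ * b   ∎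

log₂ : (k : ℕ) → .{{NonZero k}} → ℝ
log₂ k = record
  { Lower         = Pow2< k
  ; Upper         = k <Pow2
  ; lower-inhab   = mkℚᵘ -[1+ 0 ] 0 , ℕ.*-mono-≤ (ℕ.m^n>0 k 1) (ℕ.≤-refl {2})
  ; upper-inhab   = mkℚᵘ (+ k) 0 , subst (_< 2 ^ k)
      (sym (trans (ℕ.*-identityʳ (k ^ 1)) (ℕ.^-identityʳ k))) (n<2^n k)
  ; lower-rounded = λ s → mk⇔ (lower-open k s) (λ (_ , s<r , lr) → lower-closed k s<r lr)
  ; upper-rounded = λ s → mk⇔ (upper-open k s) (λ (_ , r<s , ur) → upper-closed k r<s ur)
  ; disjoint      = λ s → ℕ.<-asym
  ; located       = λ s r s<r → loc s r s<r
  }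
  where
  loc : ∀ s r → s ℚ.< r → (Pow2< k) s ⊎ (k <Pow2) r
  loc s r s<r with lower? k s
  ... | yes l = inj₁ l
  ... | no ¬l = inj₂ (¬lower⇒upper k s<r ¬l)

{-# OPTIONS --safe #-}

-- By maximality, the Hamming balls around the members of a largest family
-- cover all graphs, provided every graph with more edges than the radius
-- contains L.  With radius c·n² the balls have size 2^(η(c)·n²) with η(c) → 0
-- as c → 0, so the family has size 2^((1 - o(1))·n²/2).  That a graph of positive
-- edge density contains L is dependent random choice: for t > r/ε, the common
-- neighbourhood U of some t-tuple of vertices has more than m elements, and
-- every r-tuple in U has at least 2m common neighbours.  Put B into U and
-- choose the images of the vertices of A greedily among the common neighbours
-- of the images of their neighbours.

module Submission where

open import Defs
open import Data.Bool.Base using (Bool; true; false; if_then_else_; T; _xor_)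
import Data.Bool.Properties as Bool
open import Data.Fin.Base as Fin using (Fin; zero; suc; combine; finToFun; funToFin; splitAt; _↑ˡ_; _↑ʳ_)
import Data.Fin.Properties as Fin
open import Data.Fin.Subset using (Subset; inside; outside; _∈_; _∩_; ∣_∣)
import Data.Fin.Subset.Properties as Subset
open import Data.Integer.Base as ℤ using ()
import Data.Integer.Properties as ℤ
open import Data.Nat.Base hiding (_/_; _%_)
open import Data.Nat.Combinatorics using (_C_; nCk+nC[k+1]≡[n+1]C[k+1]; nC1≡n)
open import Data.Nat.DivMod using (_/_; _%_; m≡m%n+[m/n]*n; m%n<n; m/n*n≤m; m≥n⇒m/n>0)
open import Data.Nat.Properties hiding (_≟_)
open import Algebra.Properties.Semiring.Sum +-*-semiring
open import Algebra.Properties.Monoid.Sum *-1-monoid using () renaming (sum to product; sum-cong-≗ to product-cong)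
open import Data.Nat.Solver using (module +-*-Solver)
open import Data.Product.Base using (∃; ∃-syntax; _×_; _,_; proj₁; proj₂)
open import Data.Rational.Unnormalised.Base as ℚ using (mkℚᵘ; ↧ₙ_; 0ℚᵘ; 1ℚᵘ; *≡*)
import Data.Rational.Unnormalised.Properties as ℚ
open import Data.Sum.Base using (inj₁; inj₂)
open import Data.Vec.Base using (Vec; []; _∷_; _++_; lookup; tabulate; take; drop)
open import Data.Vec.Functional as Vector using (Vector)
open import Data.Vec.Properties
  using (lookup∘tabulate; tabulate∘lookup; tabulate-cong; take++drop≡id; ++-injective; lookup⇒[]=)
open import Function.Base using (_∘_; const; id)
open import Function.Bundles using (Equivalence)
open import Function.Definitions using (Injective)
open import Relation.Binary.PropositionalEquality
open import Relation.Nullary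
open import Relation.Nullary.Decidable using (dec-true; dec-false; decidable-stable)

private variable
  k l m n r N : ℕ

-- Finite sums and products of natural numbers

𝟙 : Bool → ℕ
𝟙 b = if b then 1 else 0

𝟙≤1 : ∀ b → 𝟙 b ≤ 1
𝟙≤1 true  = ≤-refl
𝟙≤1 false = z≤n

𝟙-*-≤ : ∀ {P : Set} {x y} (d : Dec P) → (P → x ≤ y) → 𝟙 (does d) * x ≤ y
𝟙-*-≤ (yes p) x≤y = ≤-trans (≤-reflexive (+-identityʳ _)) (x≤y p)
𝟙-*-≤ (no _)  _   = z≤n

sum-mono-≤ : {f g : Vector ℕ n} → (∀ i → f i ≤ g i) → sum f ≤ sum g
sum-mono-≤ {zero}  f≤g = z≤n
sum-mono-≤ {suc n} f≤g = +-mono-≤ (f≤g zero) (sum-mono-≤ (f≤g ∘ suc))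

sum-const : ∀ n c → ∑[ i < n ] c ≡ n * c
sum-const zero    c = refl
sum-const (suc n) c = cong (c +_) (sum-const n c)

lookup≤sum : (f : Vector ℕ n) → ∀ i → f i ≤ sum f
lookup≤sum f zero    = m≤m+n _ _
lookup≤sum f (suc i) = m≤n⇒m≤o+n (f zero) (lookup≤sum (f ∘ suc) i)

sum-<⇒∃< : (f g : Vector ℕ n) → sum f < sum g → ∃[ i ] f i < g i
sum-<⇒∃< {suc n} f g lt with f zero <? g zero
... | yes f₀<g₀ = zero , f₀<g₀
... | no f₀≮g₀ with i , fᵢ<gᵢ ← sum-<⇒∃< (f ∘ suc) (g ∘ suc)
        (+-cancelˡ-< (f zero) _ _ (<-≤-trans lt (+-monoˡ-≤ _ (≮⇒≥ f₀≮g₀))))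
      = suc i , fᵢ<gᵢ

sum-++ : ∀ k (f : Vector ℕ (k + l)) → sum f ≡ sum (λ i → f (i ↑ˡ l)) + sum (λ j → f (k ↑ʳ j))
sum-++ zero    f = refl
sum-++ (suc k) f = trans (cong (f zero +_) (sum-++ k (f ∘ suc))) (sym (+-assoc (f zero) _ _))

sum-combine : ∀ k l (f : Vector ℕ (k * l)) → sum f ≡ ∑[ i < k ] ∑[ j < l ] f (combine i j)
sum-combine zero    l f = refl
sum-combine (suc k) l f = trans (sum-++ l f) (cong (sum (λ j → f (j ↑ˡ (k * l))) +_) (sum-combine k l (f ∘ (l ↑ʳ_))))

product-pos : {f : Vector ℕ n} → (∀ i → 0 < f i) → 0 < product f
product-pos {zero}  pos = z<s
product-pos {suc n} pos = *-mono-< (pos zero) (product-pos (pos ∘ suc))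

product-pos⁻¹ : (f : Vector ℕ n) → 0 < product f → ∀ i → 0 < f i
product-pos⁻¹ f pos zero    = n≢0⇒n>0 λ eq → <⇒≢ pos (sym (cong (_* product (f ∘ suc)) eq))
product-pos⁻¹ f pos (suc i) = product-pos⁻¹ (f ∘ suc)
  (n≢0⇒n>0 λ eq → <⇒≢ pos (sym (trans (cong (f zero *_) eq) (*-zeroʳ (f zero))))) i

product≤1 : {f : Vector ℕ n} → (∀ i → f i ≤ 1) → product f ≤ 1
product≤1 {zero}  f≤1 = ≤-refl
product≤1 {suc n} f≤1 = *-mono-≤ (f≤1 zero) (product≤1 (f≤1 ∘ suc))

-- Expanding the power gives one term per `t`-tuple, with tuples coded by `finToFun`. For a
-- 0/1-valued `p` this counts the `t`-tuples inside a set.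
sum-product-tuples : ∀ t (p : Vector ℕ n) →
  ∑[ c < n ^ t ] product (p ∘ finToFun {n} {t} c) ≡ sum p ^ t
sum-product-tuples zero    p = refl
sum-product-tuples {n} (suc t) p = begin
  ∑[ c < n * n ^ t ] product (p ∘ finToFun {n} {suc t} c)
    ≡⟨ sum-combine n (n ^ t) _ ⟩
  ∑[ x < n ] ∑[ c < n ^ t ] product (p ∘ finToFun {n} {suc t} (combine x c))
    ≡⟨ sum-cong-≗ (λ x → sum-cong-≗ λ c →
         cong (λ (y , c′) → p y * product (p ∘ finToFun {n} {t} c′)) (Fin.remQuot-combine x c)) ⟩
  ∑[ x < n ] ∑[ c < n ^ t ] (p x * product (p ∘ finToFun {n} {t} c))
    ≡⟨ sum-cong-≗ (λ x → *-distribˡ-sum (p x) λ c → product (p ∘ finToFun {n} {t} c)) ⟨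
  ∑[ x < n ] (p x * ∑[ c < n ^ t ] product (p ∘ finToFun {n} {t} c))
    ≡⟨ sum-cong-≗ (λ x → cong (p x *_) (sum-product-tuples t p)) ⟩
  ∑[ x < n ] (p x * sum p ^ t)
    ≡⟨ *-distribʳ-sum (sum p ^ t) p ⟨
  sum p * sum p ^ t ∎
  where open ≡-Reasoning

-- Systems of distinct representatives

sum-δ : (y : Fin n) → ∑[ x < n ] 𝟙 (does (y Fin.≟ x)) ≡ 1
sum-δ {suc n} zero    = cong suc (trans (sum-const n 0) (*-zeroʳ n))
sum-δ {suc n} (suc y) = sum-δ y

sum-hits : (f : Fin k → Fin n) → ∑[ x < n ] ∑[ i < k ] 𝟙 (does (f i Fin.≟ x)) ≡ k
sum-hits {k} {n} f = trans (∑-comm {n} {k} (λ x i → 𝟙 (does (f i Fin.≟ x)))) (trans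
  (sum-cong-≗ {k} (λ i → sum-δ (f i))) (trans (sum-const k 1) (*-identityʳ k)))

-- The values of `f` hit the points `k` times in total, fewer than `sum p`, so some point is hit
-- fewer than `p x ≤ 1` times, that is, never.
∃-avoiding : (p : Vector ℕ n) → (∀ x → p x ≤ 1) → (f : Fin k → Fin n) → k < sum p →
  ∃[ x ] 0 < p x × (∀ i → f i ≢ x)
∃-avoiding {n} {k} p p≤1 f k<∑p
  with x , hits<px ← sum-<⇒∃< (λ x → ∑[ i < k ] 𝟙 (does (f i Fin.≟ x))) p
         (subst (_< sum p) (sym (sum-hits f)) k<∑p)
  = x , ≤-<-trans z≤n hits<px , λ i fi≡x → <⇒≱ hits<px (begin
      p x                                        ≤⟨ p≤1 x ⟩
      1                                          ≡⟨ cong 𝟙 (dec-true (f i Fin.≟ x) fi≡x) ⟨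
      𝟙 (does (f i Fin.≟ x))                     ≤⟨ lookup≤sum (λ i → 𝟙 (does (f i Fin.≟ x))) i ⟩
      ∑[ i < k ] 𝟙 (does (f i Fin.≟ x))          ∎)
  where open ≤-Reasoning

-- Greedy choice, with `g` listing the points already used. Each choice moves one unit from `k` to
-- `l`, so the required size `l + k` never changes.
distinctRepresentatives : (p : Fin k → Vector ℕ n) → (∀ i x → p i x ≤ 1) →
  (g : Fin l → Fin n) → (∀ i → l + k ≤ sum (p i)) →
  ∃ λ (f : Fin k → Fin n) → Injective _≡_ _≡_ f × (∀ i → 0 < p i (f i)) × (∀ i j → g j ≢ f i)
distinctRepresentatives {zero} p p≤1 g large = (λ ()) , (λ {i} → contradiction i λ ()) , (λ ()) , λ ()
distinctRepresentatives {suc k} {n} {l} p p≤1 g large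
  with x , px>0 , x∉g ← ∃-avoiding (p zero) (p≤1 zero) g
         (<-≤-trans (m<m+n l z<s) (large zero))
  with f , f-inj , pf>0 , f-avoids ← distinctRepresentatives (p ∘ suc) (p≤1 ∘ suc) (x Vector.∷ g)
         (λ i → subst (_≤ sum (p (suc i))) (+-suc l k) (large (suc i)))
  = x Vector.∷ f
  , (λ { {zero}  {zero}  _  → refl
       ; {zero}  {suc j} eq → contradiction eq (f-avoids j zero)
       ; {suc i} {zero}  eq → contradiction (sym eq) (f-avoids i zero)
       ; {suc i} {suc j} eq → cong suc (f-inj eq) })
  , (λ { zero → px>0 ; (suc i) → pf>0 i })
  , (λ { zero → x∉g ; (suc i) j → f-avoids i (suc j) })

-- Dependent random choice

module _ (G : Graph n) where

  edge : Fin n → Fin n → ℕ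
  edge u v = 𝟙 (adj G u v)

  degree : Fin n → ℕ
  degree v = sum (edge v)

  -- A 0/1-valued product, so `sum (common s)` is the number of common neighbours of `s`; entries of
  -- `s` may repeat.
  common : (Fin k → Fin n) → Vector ℕ n
  common s x = product (edge x ∘ s)

edge≤1 : (G : Graph n) → ∀ u v → edge G u v ≤ 1
edge≤1 G u v = 𝟙≤1 (adj G u v)

edge-sym : (G : Graph n) → ∀ u v → edge G u v ≡ edge G v u
edge-sym G u v = cong 𝟙 (symm G u v)

common≤1 : (G : Graph n) (s : Fin k → Fin n) → ∀ x → common G s x ≤ 1
common≤1 G s x = product≤1 (λ i → edge≤1 G x (s i))

degree≤n : (G : Graph n) → ∀ v → degree G v ≤ n
degree≤n {n} G v = ≤-trans (sum-mono-≤ (edge≤1 G v)) (≤-reflexive (trans (sum-const n 1) (*-identityʳ n)))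

-- Pointwise D^t·x ≤ n·x^t + D^(t+1); this replaces Jensen's inequality.
power-sum-bound : ∀ t D (f : Vector ℕ n) → .{{NonZero n}} → (∀ i → f i ≤ n) →
  2 * (n * D) ≤ sum f → D ^ suc t ≤ ∑[ i < n ] (f i ^ t)
-- The factor 2 in `large` pays for the constant terms `D ^ suc t` of the pointwise bound.
power-sum-bound {n} t D f f≤n large = *-cancelˡ-≤ n (+-cancelʳ-≤ (n * D ^ suc t) _ _ (begin
  n * D ^ suc t + n * D ^ suc t
    ≡⟨ solve 3 (λ n d p → n :* (d :* p) :+ n :* (d :* p) := p :* (con 2 :* (n :* d))) refl n D (D ^ t) ⟩
  D ^ t * (2 * (n * D))            ≤⟨ *-monoʳ-≤ (D ^ t) large ⟩
  D ^ t * sum f                    ≡⟨ *-distribˡ-sum (D ^ t) f ⟩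
  ∑[ i < n ] (D ^ t * f i)         ≤⟨ sum-mono-≤ pointwise ⟩
  ∑[ i < n ] (n * f i ^ t + D ^ suc t)
    ≡⟨ ∑-distrib-+ (λ i → n * f i ^ t) (λ _ → D ^ suc t) ⟩
  ∑[ i < n ] (n * f i ^ t) + ∑[ i < n ] (D ^ suc t)
    ≡⟨ cong₂ _+_ (sym (*-distribˡ-sum n (λ i → f i ^ t))) (sum-const n (D ^ suc t)) ⟩
  n * ∑[ i < n ] (f i ^ t) + n * D ^ suc t ∎))
  where
  open ≤-Reasoning
  open +-*-Solver
  pointwise : ∀ i → D ^ t * f i ≤ n * f i ^ t + D ^ suc t
  pointwise i with ≤-total D (f i)
  ... | inj₁ D≤fi = m≤n⇒m≤n+o (D ^ suc t) (≤-trans (*-mono-≤ (^-monoˡ-≤ t D≤fi) (f≤n i)) (≤-reflexive (*-comm _ n)))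
  ... | inj₂ fi≤D = m≤n⇒m≤o+n (n * f i ^ t) (≤-trans (*-monoʳ-≤ (D ^ t) fi≤D) (≤-reflexive (*-comm _ D)))

-- poor c counts the r-tuples with fewer than K common neighbours that lie in the
-- common neighbourhood of the t-tuple τ c.  Membership is phrased as "τ c lies in
-- the common neighbourhood of σ d", so that sum-product-tuples applies.
module _ (G : Graph n) (t r K : ℕ) where
  open ≤-Reasoning

  private
    τ : Fin (n ^ t) → Fin t → Fin n
    τ = finToFun

    σ : Fin (n ^ r) → Fin r → Fin n
    σ = finToFun

    few : Fin (n ^ r) → ℕ
    few d = 𝟙 (does (sum (common G (σ d)) <? K))

  poor : Fin (n ^ t) → ℕ
  poor c = ∑[ d < n ^ r ] (few d * product (common G (σ d) ∘ τ c))

  -- Exchange the sums: the common neighbourhood of a tuple counted by `few` contains at most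
  -- `K ^ t` of the `t`-tuples.
  sum-poor : sum poor ≤ n ^ r * K ^ t
  sum-poor = begin
    ∑[ c < n ^ t ] ∑[ d < n ^ r ] (few d * product (common G (σ d) ∘ τ c))
      ≡⟨ ∑-comm {n ^ t} {n ^ r} (λ c d → few d * product (common G (σ d) ∘ τ c)) ⟩
    ∑[ d < n ^ r ] ∑[ c < n ^ t ] (few d * product (common G (σ d) ∘ τ c))
      ≡⟨ sum-cong-≗ {n ^ r} (λ d → *-distribˡ-sum (few d) (λ c → product (common G (σ d) ∘ τ c))) ⟨
    ∑[ d < n ^ r ] (few d * ∑[ c < n ^ t ] product (common G (σ d) ∘ τ c))
      ≡⟨ sum-cong-≗ {n ^ r} (λ d → cong (few d *_) (sum-product-tuples t (common G (σ d)))) ⟩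
    ∑[ d < n ^ r ] (few d * sum (common G (σ d)) ^ t)
      ≤⟨ sum-mono-≤ (λ d → 𝟙-*-≤ (sum (common G (σ d)) <? K) (^-monoˡ-≤ t ∘ <⇒≤)) ⟩
    ∑[ d < n ^ r ] (K ^ t)
      ≡⟨ sum-const (n ^ r) (K ^ t) ⟩
    n ^ r * K ^ t ∎

  -- The tuple `s` itself contributes a positive term. Symmetry of adjacency turns "`s` lies in the
  -- common neighbourhood of `τ c`" into the form used in `poor`.
  poor-pos : ∀ c (s : Fin r → Fin n) → (∀ i → 0 < common G (τ c) (s i)) →
    sum (common G s) < K → 0 < poor c
  poor-pos c s s⊆U <K = <-≤-trans (*-mono-< few>0 inside>0)
      (lookup≤sum (λ d → few d * product (common G (σ d) ∘ τ c)) d)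
    where
    d = funToFin s
    σ≗s : ∀ i → σ d i ≡ s i
    σ≗s = Fin.finToFun-funToFin s
    few>0 : 0 < few d
    few>0 = subst (0 <_) (sym (cong 𝟙 (dec-true (_ <? K) (subst (_< K)
      (sum-cong-≗ {n} (λ x → product-cong {r} λ i → cong (edge G x) (sym (σ≗s i)))) <K)))) z<s
    inside>0 : 0 < product (common G (σ d) ∘ τ c)
    inside>0 = product-pos λ j → product-pos λ i → subst (0 <_)
      (trans (edge-sym G (s i) (τ c j)) (cong (edge G (τ c j)) (sym (σ≗s i))))
      (product-pos⁻¹ (edge G (s i) ∘ τ c) (s⊆U i) j)

-- This is an expectation bound multiplied by `n ^ t`: the sizes of the common neighbourhoods add up
-- to the `t`-th powers of the degrees. The weight `n` makes a single poor tuple too expensive, so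
-- that no vertices have to be deleted afterwards.
average-gap : (G : Graph n) → .{{NonZero n}} → ∀ D t r K m →
  2 * (n * D) ≤ sum (degree G) → n ^ t * m + n ^ r * n * K ^ t < D ^ suc t →
  ∑[ c < n ^ t ] (m + n * poor G t r K c) < ∑[ c < n ^ t ] sum (common G (finToFun {n} {t} c))
average-gap {n} G D t r K m dense lt = begin-strict
  ∑[ c < n ^ t ] (m + n * poor G t r K c)
    ≡⟨ ∑-distrib-+ (λ (_ : Fin (n ^ t)) → m) (λ c → n * poor G t r K c) ⟩
  ∑[ c < n ^ t ] m + ∑[ c < n ^ t ] (n * poor G t r K c)
    ≡⟨ cong₂ _+_ (sum-const (n ^ t) m) (sym (*-distribˡ-sum n (poor G t r K))) ⟩
  n ^ t * m + n * sum (poor G t r K)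
    ≤⟨ +-monoʳ-≤ (n ^ t * m) (*-monoʳ-≤ n (sum-poor G t r K)) ⟩
  n ^ t * m + n * (n ^ r * K ^ t)
    ≡⟨ solve 4 (λ a n b c → a :+ n :* (b :* c) := a :+ b :* n :* c) refl (n ^ t * m) n (n ^ r) (K ^ t) ⟩
  n ^ t * m + n ^ r * n * K ^ t
    <⟨ lt ⟩
  D ^ suc t
    ≤⟨ power-sum-bound t D (degree G) (degree≤n G) dense ⟩
  ∑[ v < n ] (degree G v ^ t)
    ≡⟨ sum-cong-≗ (λ v → sum-product-tuples t (edge G v)) ⟨
  ∑[ v < n ] ∑[ c < n ^ t ] common G (finToFun {n} {t} c) v
    ≡⟨ ∑-comm {n} {n ^ t} (λ v c → common G (finToFun {n} {t} c) v) ⟩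
  ∑[ c < n ^ t ] sum (common G (finToFun {n} {t} c)) ∎
  where
  open ≤-Reasoning
  open +-*-Solver

dependentRandomChoice : (G : Graph n) → .{{NonZero n}} → ∀ D t r K m →
  2 * (n * D) ≤ sum (degree G) → n ^ t * m + n ^ r * n * K ^ t < D ^ suc t →
  ∃ λ (τ : Fin t → Fin n) → m < sum (common G τ) ×
    (∀ (s : Fin r → Fin n) → (∀ i → 0 < common G τ (s i)) → K ≤ sum (common G s))
dependentRandomChoice {n} G D t r K m dense lt
  with c , lt′ ← sum-<⇒∃< _ _ (average-gap G D t r K m dense lt)
  = finToFun c , ≤-<-trans (m≤m+n m _) lt′ , λ s s⊆U → ≮⇒≥ λ <K →
      -- A poor tuple would raise the left side of `lt′` to at least `n`, which no neighbourhood
      -- exceeds.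
      <⇒≱ lt′ (begin
        sum (common G (finToFun {n} {t} c))  ≤⟨ sum-mono-≤ (common≤1 G (finToFun {n} {t} c)) ⟩
        ∑[ v < n ] 1                 ≡⟨ sum-const n 1 ⟩
        n * 1                        ≤⟨ *-monoʳ-≤ n (poor-pos G t r K c s s⊆U <K) ⟩
        n * poor G t r K c           ≤⟨ m≤n+m _ m ⟩
        m + n * poor G t r K c       ∎)
  where open ≤-Reasoning

-- Embedding

-- Padding with the default value gives exactly `r` entries, the tuple length for which many common
-- neighbours are guaranteed.
enumerate : ∀ {A : Set} (g : Fin m → A) (S : Subset m) → ∣ S ∣ ≤ r → A →
  ∃ λ (s : Fin r → A) → ∀ v → v ∈ S → ∃[ i ] s i ≡ g v
enumerate g [] _ x = const x , λ ()
enumerate g (outside ∷ S) S≤r x with s , covers ← enumerate (g ∘ suc) S S≤r x =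
  s , λ { (suc v) v∈S → covers v (Subset.drop-there v∈S) }
enumerate {r = suc r} g (inside ∷ S) (s≤s S≤r) x with s , covers ← enumerate (g ∘ suc) S S≤r x =
  g zero Vector.∷ s , λ
    { zero _ → zero , refl
    ; (suc v) v∈S → let i , eq = covers v (Subset.drop-there v∈S) in suc i , eq }

𝟙-pos : ∀ b → 0 < 𝟙 b → T b
𝟙-pos true _ = _

module _ {L : Graph m} {A B : Subset m} (isL : IsL r L A B) (G : Graph n) where
  open IsL isL
  open IsBipartition bipartition

  -- Vertices outside `A` get a dummy tuple, so that images can be chosen uniformly for all of
  -- `Fin m`.
  neighbourTuple : ∀ v → ∃ λ (s : Fin r → Fin m) → v ∈ A → ∀ w → w ∈ neighbours L v ∩ B → ∃[ i ] s i ≡ w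
  neighbourTuple v with v Subset.∈? A
  ... | no v∉A  = const v , λ v∈A → contradiction v∈A v∉A
  ... | yes v∈A with s , covers ← enumerate id (neighbours L v ∩ B) (boundedDegree v v∈A) v =
        s , λ _ → covers

  module _ (g h : Fin m → Fin n) where
    private
      f : Fin m → Fin n
      f v = if does (v Subset.∈? A) then h v else g v

      f-A : ∀ {v} → v ∈ A → f v ≡ h v
      f-A {v} v∈A = cong (λ b → if b then h v else g v) (dec-true (v Subset.∈? A) v∈A)

      f-B : ∀ {v} → v ∈ B → f v ≡ g v
      f-B {v} v∈B = cong (λ b → if b then h v else g v) (dec-false (v Subset.∈? A) λ v∈A →
        Subset.∉⊥ (subst (v ∈_) disjoint (Subset.x∈p∩q⁺ (v∈A , v∈B))))

      f-injective : Injective _≡_ _≡_ g → Injective _≡_ _≡_ h → (∀ i j → g j ≢ h i) → ∀ u v → f u ≡ f v → u ≡ v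
      f-injective g-inj h-inj h∉g u v eq with u Subset.∈? A | v Subset.∈? A
      ... | yes _ | yes _ = h-inj eq
      ... | yes _ | no  _ = contradiction (sym eq) (h∉g u v)
      ... | no  _ | yes _ = contradiction eq (h∉g v u)
      ... | no  _ | no  _ = g-inj eq

    -- Both `g` and `h` place every vertex; `f` follows `h` on `A` and `g` elsewhere. Every edge of
    -- `L` joins `A` to `B`, so `h-common` covers it.
    glue : Injective _≡_ _≡_ g → Injective _≡_ _≡_ h → (∀ i j → g j ≢ h i) →
      (∀ v → 0 < common G (g ∘ proj₁ (neighbourTuple v)) (h v)) → L ⊑ G
    glue g-inj h-inj h∉g h-common = f , (λ {u} {v} → f-injective g-inj h-inj h∉g u v) , f-hom
      where
      f-hom-AB : ∀ u v → Adj L u v → u ∈ A → v ∈ B → Adj G (f u) (f v)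
      f-hom-AB u v uv u∈A v∈B
        with i , s≡v ← proj₂ (neighbourTuple u) u∈A v (Subset.x∈p∩q⁺
               (lookup⇒[]= v (neighbours L u) (trans (lookup∘tabulate (adj L u) v) (Equivalence.to Bool.T-≡ uv)) , v∈B))
        = subst₂ (Adj G) (sym (f-A u∈A)) (trans (cong g s≡v) (sym (f-B v∈B)))
            (𝟙-pos _ (product-pos⁻¹ (edge G (h u) ∘ g ∘ proj₁ (neighbourTuple u)) (h-common u) i))

      f-hom : ∀ u v → Adj L u v → Adj G (f u) (f v)
      f-hom u v uv with crossing u v uv
      ... | inj₁ (u∈A , v∈B) = f-hom-AB u v uv u∈A v∈B
      ... | inj₂ (u∈B , v∈A) = subst T (symm G (f v) (f u)) (f-hom-AB v u (subst T (symm L u v) uv) v∈A u∈B)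

  embedding : (U : Vector ℕ n) → (∀ x → U x ≤ 1) → m ≤ sum U →
    (∀ (s : Fin r → Fin n) → (∀ i → 0 < U (s i)) → m + m ≤ sum (common G s)) → L ⊑ G
  embedding U U≤1 m≤U rich
    with g , g-inj , g∈U , _ ← distinctRepresentatives {m} {n} {0} (λ _ → U) (λ _ → U≤1) (λ ()) (λ _ → m≤U)
    -- The `m` images under `g` are avoided while `m` new ones are chosen, which is why `m + m`
    -- common neighbours are required.
    with h , h-inj , h-common , h∉g ← distinctRepresentatives
           (λ v → common G (g ∘ proj₁ (neighbourTuple v))) (λ v → common≤1 G (g ∘ proj₁ (neighbourTuple v)))
           g (λ v → rich _ (λ i → g∈U (proj₁ (neighbourTuple v) i)))
    = glue g h g-inj h-inj h∉g h-common

dense⇒⊒ : {L : Graph m} {A B : Subset m} → IsL r L A B → (G : Graph n) → .{{NonZero n}} → ∀ D t →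
  2 * (n * D) ≤ sum (degree G) → n ^ t * m + n ^ r * n * (m + m) ^ t < D ^ suc t → L ⊑ G
dense⇒⊒ {m} {r} isL G D t dense lt =
  let τ , large , rich = dependentRandomChoice G D t r (m + m) m dense lt
  in embedding isL G (common G τ) (common≤1 G τ) (<⇒≤ large) rich

-- Graphs as words

-- The binomial coefficient `n C 2`, in the recursive form that matches listing the entries above
-- the diagonal row by row.
pairs : ℕ → ℕ
pairs zero    = 0
pairs (suc n) = n + pairs n

pairs≡C2 : ∀ n → pairs n ≡ n C 2
pairs≡C2 zero    = refl
pairs≡C2 (suc n) = trans (cong₂ _+_ (sym (nC1≡n n)) (pairs≡C2 n)) (nCk+nC[k+1]≡[n+1]C[k+1] n 1)

removeZero : Graph (suc n) → Graph n
adj    (removeZero G) u v = adj G (suc u) (suc v)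
symm   (removeZero G) u v = symm G (suc u) (suc v)
irrefl (removeZero G) v   = irrefl G (suc v)

toWord : Graph n → Vec Bool (pairs n)
toWord {zero}  G = []
toWord {suc n} G = tabulate (adj G zero ∘ suc) ++ toWord (removeZero G)

toWord-injective : (G H : Graph n) → toWord G ≡ toWord H → G ≈ H
toWord-injective {suc n} G H eq = go
  where
  row,rest = ++-injective (tabulate (adj G zero ∘ suc)) (tabulate (adj H zero ∘ suc)) eq
  row : ∀ j → adj G zero (suc j) ≡ adj H zero (suc j)
  row j = trans (sym (lookup∘tabulate _ j)) (trans (cong (λ w → lookup w j) (proj₁ row,rest)) (lookup∘tabulate _ j))
  go : G ≈ H
  go zero    zero    = trans (irrefl G zero) (sym (irrefl H zero))
  go zero    (suc v) = row v
  go (suc u) zero    = trans (symm G (suc u) zero) (trans (row u) (symm H zero (suc u)))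
  go (suc u) (suc v) = toWord-injective (removeZero G) (removeZero H) (proj₂ row,rest) u v

fromWord : ∀ n → Vec Bool (pairs n) → Graph n
fromWord zero    w = record { adj = λ () ; symm = λ () ; irrefl = λ () }
fromWord (suc n) w = record { adj = a ; symm = s ; irrefl = i }
  where
  G = fromWord n (drop n w)
  a : Fin (suc n) → Fin (suc n) → Bool
  a zero    zero    = false
  a zero    (suc v) = lookup (take n w) v
  a (suc u) zero    = lookup (take n w) u
  a (suc u) (suc v) = adj G u v
  s : ∀ u v → a u v ≡ a v u
  s zero    zero    = refl
  s zero    (suc v) = refl
  s (suc u) zero    = refl
  s (suc u) (suc v) = symm G u v
  i : ∀ v → a v v ≡ false
  i zero    = refl
  i (suc v) = irrefl G v

toWord-cong : {G H : Graph n} → G ≈ H → toWord G ≡ toWord H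
toWord-cong {zero}  G≈H = refl
toWord-cong {suc n} G≈H = cong₂ _++_ (tabulate-cong λ v → G≈H zero (suc v))
  (toWord-cong λ u v → G≈H (suc u) (suc v))

toWord-fromWord : ∀ n w → toWord (fromWord n w) ≡ w
toWord-fromWord zero    []  = refl
toWord-fromWord (suc n) w = trans
  (cong₂ _++_ (tabulate∘lookup (take n w))
    (trans (toWord-cong {n} λ u v → refl) (toWord-fromWord n (drop n w))))
  (take++drop≡id n w)

weight : Vec Bool n → ℕ
weight []      = 0
weight (b ∷ w) = 𝟙 b + weight w

weight-++ : (v : Vec Bool m) (w : Vec Bool n) → weight (v ++ w) ≡ weight v + weight w
weight-++ []      w = refl
weight-++ (b ∷ v) w = trans (cong (𝟙 b +_) (weight-++ v w)) (sym (+-assoc (𝟙 b) _ _))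

weight-tabulate : (f : Fin n → Bool) → weight (tabulate f) ≡ ∑[ i < n ] 𝟙 (f i)
weight-tabulate {zero}  f = refl
weight-tabulate {suc n} f = cong (𝟙 (f zero) +_) (weight-tabulate (f ∘ suc))

handshake : (G : Graph n) → sum (degree G) ≡ 2 * weight (toWord G)
handshake {zero}  G = refl
handshake {suc n} G = begin
  (edge G zero zero + row) + ∑[ i < n ] (edge G (suc i) zero + degree G′ i)
    ≡⟨ cong₂ _+_ (cong (λ b → 𝟙 b + row) (irrefl G zero))
         (∑-distrib-+ (λ i → edge G (suc i) zero) (degree G′)) ⟩
  row + (∑[ i < n ] edge G (suc i) zero + sum (degree G′))
    ≡⟨ cong₂ (λ x y → row + (x + y)) (sum-cong-≗ {n} λ i → edge-sym G (suc i) zero) (handshake G′) ⟩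
  row + (row + 2 * weight (toWord G′))
    ≡⟨ solve 2 (λ x y → x :+ (x :+ con 2 :* y) := con 2 :* (x :+ y)) refl row (weight (toWord G′)) ⟩
  2 * (row + weight (toWord G′))
    ≡⟨ cong (λ x → 2 * (x + weight (toWord G′))) (weight-tabulate (adj G zero ∘ suc)) ⟨
  2 * (weight (tabulate (adj G zero ∘ suc)) + weight (toWord G′))
    ≡⟨ cong (2 *_) (weight-++ (tabulate (adj G zero ∘ suc)) (toWord G′)) ⟨
  2 * weight (toWord G) ∎
  where
  open ≡-Reasoning
  open +-*-Solver
  G′ = removeZero G
  row = ∑[ j < n ] edge G zero (suc j)

edgeless⇒weight≡0 : (G : Graph n) → (∀ u v → adj G u v ≡ false) → weight (toWord G) ≡ 0
edgeless⇒weight≡0 {zero}  G none = refl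
edgeless⇒weight≡0 {suc n} G none = trans (weight-++ (tabulate (adj G zero ∘ suc)) _)
  (cong₂ _+_ (trans (weight-tabulate (adj G zero ∘ suc)) (trans (sum-cong-≗ {n} λ v → cong 𝟙 (none zero (suc v)))
               (trans (sum-const n 0) (*-zeroʳ n))))
             (edgeless⇒weight≡0 (removeZero G) λ u v → none (suc u) (suc v)))

funToFin-cong : {f g : Fin m → Fin n} → (∀ i → f i ≡ g i) → funToFin f ≡ funToFin g
funToFin-cong {zero}  f≗g = refl
funToFin-cong {suc m} f≗g = cong₂ combine (f≗g zero) (funToFin-cong (f≗g ∘ suc))

bit-unbit : ∀ i → bit (unbit i) ≡ i
bit-unbit zero       = refl
bit-unbit (suc zero) = refl

-- Words coded as numbers, so that sizes can be compared by injections between `Fin` types.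
wordIndex : Vec Bool N → Fin (2 ^ N)
wordIndex w = funToFin (bit ∘ lookup w)

wordIndex-injective : (v w : Vec Bool N) → wordIndex v ≡ wordIndex w → v ≡ w
wordIndex-injective v w eq = trans (sym (tabulate∘lookup v)) (trans (tabulate-cong λ i → begin
    lookup v i                                ≡⟨ decode-lookup v i ⟨
    unbit (finToFun {2} (wordIndex v) i)      ≡⟨ cong (λ c → unbit (finToFun {2} c i)) eq ⟩
    unbit (finToFun {2} (wordIndex w) i)      ≡⟨ decode-lookup w i ⟩
    lookup w i                                ∎)
  (tabulate∘lookup w))
  where
  open ≡-Reasoning
  decode-lookup : ∀ {N} (w : Vec Bool N) i → unbit (finToFun {2} {N} (wordIndex w) i) ≡ lookup w i
  decode-lookup w i = trans (cong unbit (Fin.finToFun-funToFin (bit ∘ lookup w) i)) (unbit-bit (lookup w i))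

wordAt : Fin (2 ^ N) → Vec Bool N
wordAt c = tabulate (unbit ∘ finToFun {2} c)

wordIndex-wordAt : (c : Fin (2 ^ N)) → wordIndex {N} (wordAt c) ≡ c
wordIndex-wordAt {N} c = trans
  (funToFin-cong {N} {2} λ i → trans (cong bit (lookup∘tabulate (unbit ∘ finToFun {2} {N} c) i)) (bit-unbit _))
  (Fin.funToFin-finToFin {N} {2} c)

wordAt-injective : (c d : Fin (2 ^ N)) → wordAt {N} c ≡ wordAt d → c ≡ d
wordAt-injective {N} c d eq =
  trans (sym (wordIndex-wordAt {N} c)) (trans (cong wordIndex eq) (wordIndex-wordAt {N} d))

-- Hamming balls

private variable
  d : ℕ

-- The sum of the binomial coefficients `N C i` for `i ≤ d`, by cases on the first letter of a word.
ballSize : ℕ → ℕ → ℕ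
ballSize zero    d       = 1
ballSize (suc N) zero    = ballSize N zero
ballSize (suc N) (suc d) = ballSize N (suc d) + ballSize N d

ballIndex : (w : Vec Bool N) → weight w ≤ d → Fin (ballSize N d)
ballIndex             []          _       = zero
ballIndex {d = zero}  (false ∷ w) p       = ballIndex w p
ballIndex {d = suc d} (false ∷ w) p       = ballIndex w p ↑ˡ _
ballIndex {d = suc d} (true ∷ w)  (s≤s p) = _ ↑ʳ ballIndex w p

↑ˡ≢↑ʳ : (i : Fin m) (j : Fin n) → i ↑ˡ n ≢ m ↑ʳ j
↑ˡ≢↑ʳ {m} {n} i j eq
  with () ← trans (sym (Fin.splitAt-↑ˡ m i n)) (trans (cong (splitAt m) eq) (Fin.splitAt-↑ʳ m n j))

ballIndex-injective : (v w : Vec Bool N) (p : weight v ≤ d) (q : weight w ≤ d) →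
  ballIndex v p ≡ ballIndex w q → v ≡ w
ballIndex-injective [] [] _ _ _ = refl
ballIndex-injective {d = zero} (false ∷ v) (false ∷ w) p q eq =
  cong (false ∷_) (ballIndex-injective v w p q eq)
ballIndex-injective {d = suc d} (false ∷ v) (false ∷ w) p q eq =
  cong (false ∷_) (ballIndex-injective v w p q (Fin.↑ˡ-injective _ _ _ eq))
ballIndex-injective {d = suc d} (false ∷ v) (true ∷ w) p (s≤s q) eq = contradiction eq (↑ˡ≢↑ʳ _ _)
ballIndex-injective {d = suc d} (true ∷ v) (false ∷ w) (s≤s p) q eq = contradiction (sym eq) (↑ˡ≢↑ʳ _ _)
ballIndex-injective {suc N} {suc d} (true ∷ v) (true ∷ w) (s≤s p) (s≤s q) eq =
  cong (true ∷_) (ballIndex-injective v w p q (Fin.↑ʳ-injective (ballSize N (suc d)) _ _ eq))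

-- Generating function bound: a word of weight at most `d` has `(1/q)^weight ≥ (1/q)^d`, and these
-- powers sum to `(1 + 1/q)^N` over all words. The induction follows the recursion of `ballSize`.
ballSize-bound : ∀ q → .{{NonZero q}} → ∀ N d → ballSize N d * q ^ N ≤ suc q ^ N * q ^ d
ballSize-bound q zero    d       = ≤-trans (m^n>0 q d) (≤-reflexive (sym (+-identityʳ _)))
ballSize-bound q (suc N) zero    = begin
  ballSize N 0 * (q * q ^ N)     ≡⟨ solve 3 (λ b q p → b :* (q :* p) := q :* (b :* p)) refl (ballSize N 0) q (q ^ N) ⟩
  q * (ballSize N 0 * q ^ N)     ≤⟨ *-mono-≤ (n≤1+n q) (ballSize-bound q N 0) ⟩
  suc q * (suc q ^ N * 1)        ≡⟨ *-assoc (suc q) (suc q ^ N) 1 ⟨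
  suc q * suc q ^ N * 1          ∎
  where
  open ≤-Reasoning
  open +-*-Solver
ballSize-bound q (suc N) (suc d) = begin
  (ballSize N (suc d) + ballSize N d) * (q * q ^ N)
    ≡⟨ solve 4 (λ b c q p → (b :+ c) :* (q :* p) := q :* (b :* p) :+ q :* (c :* p)) refl
         (ballSize N (suc d)) (ballSize N d) q (q ^ N) ⟩
  q * (ballSize N (suc d) * q ^ N) + q * (ballSize N d * q ^ N)
    ≤⟨ +-mono-≤ (*-monoʳ-≤ q (ballSize-bound q N (suc d))) (*-monoʳ-≤ q (ballSize-bound q N d)) ⟩
  q * (suc q ^ N * (q * q ^ d)) + q * (suc q ^ N * q ^ d)
    ≡⟨ solve 3 (λ q s p → q :* (s :* (q :* p)) :+ q :* (s :* p) := (con 1 :+ q) :* s :* (q :* p)) refl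
         q (suc q ^ N) (q ^ d) ⟩
  suc q * suc q ^ N * (q * q ^ d) ∎
  where
  open ≤-Reasoning
  open +-*-Solver

-- (1 - 1/(y+1))^t ≥ 1 - t/(y+1), with denominators cleared.
suc-power-bound : ∀ y t → suc y ^ t * suc y ≤ y ^ t * suc y + t * suc y ^ t
suc-power-bound y zero    = ≤-reflexive (sym (+-identityʳ _))
suc-power-bound y (suc t) = begin
  s * s ^ t * s                       ≡⟨ *-assoc s (s ^ t) s ⟩
  s * (s ^ t * s)                     ≤⟨ *-monoʳ-≤ s (suc-power-bound y t) ⟩
  s * (y ^ t * s + t * s ^ t)
    ≡⟨ solve 4 (λ y p t x → (con 1 :+ y) :* (p :* (con 1 :+ y) :+ t :* x)
         := y :* p :* (con 1 :+ y) :+ (p :* (con 1 :+ y) :+ t :* ((con 1 :+ y) :* x))) refl y (y ^ t) t (s ^ t) ⟩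
  y * y ^ t * s + (y ^ t * s + t * (s * s ^ t))
    ≤⟨ +-monoʳ-≤ (y * y ^ t * s) (+-monoˡ-≤ (t * (s * s ^ t)) (*-monoˡ-≤ s (^-monoˡ-≤ t (n≤1+n y)))) ⟩
  y * y ^ t * s + (s ^ t * s + t * (s * s ^ t))
    ≡⟨ cong (λ x → y * y ^ t * s + (x + t * (s * s ^ t))) (*-comm (s ^ t) s) ⟩
  y * y ^ t * s + suc t * (s * s ^ t) ∎
  where
  open ≤-Reasoning
  open +-*-Solver
  s = suc y

-- By `suc-power-bound`, `(y/(y+1))^t ≥ 1 - t/(y+1) ≥ 1/2`.
suc-power≤double : ∀ y t → 2 * t ≤ suc y → suc y ^ t ≤ 2 * y ^ t
suc-power≤double y t 2t≤s = *-cancelʳ-≤ (s ^ t) (2 * y ^ t) s (+-cancelʳ-≤ (s ^ t * s) _ _ (begin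
  s ^ t * s + s ^ t * s                ≡⟨ solve 1 (λ x → x :+ x := con 2 :* x) refl (s ^ t * s) ⟩
  2 * (s ^ t * s)                      ≤⟨ *-monoʳ-≤ 2 (suc-power-bound y t) ⟩
  2 * (y ^ t * s + t * s ^ t)
    ≡⟨ solve 4 (λ p s t x → con 2 :* (p :* s :+ t :* x) := con 2 :* p :* s :+ x :* (con 2 :* t)) refl (y ^ t) s t (s ^ t) ⟩
  2 * y ^ t * s + s ^ t * (2 * t)      ≤⟨ +-monoʳ-≤ (2 * y ^ t * s) (*-monoʳ-≤ (s ^ t) 2t≤s) ⟩
  2 * y ^ t * s + s ^ t * s            ∎))
  where
  open ≤-Reasoning
  open +-*-Solver
  s = suc y

^-swap : ∀ x a b → (x ^ a) ^ b ≡ (x ^ b) ^ a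
^-swap x a b = trans (^-*-assoc x a b) (trans (cong (x ^_) (*-comm a b)) (sym (^-*-assoc x b a)))

-- The entropy estimate: with t = 2j and q = 2t, (1 + 1/q)^t ≤ 2.
ballSize-small : ∀ j → .{{NonZero j}} → ∀ N d → 8 * (j * j) * d < N → ballSize N d ^ j < 2 ^ N
ballSize-small j@(suc _) N d small = ^-cancelˡ-< 2 (begin-strict
  (V ^ j) ^ 2                  ≡⟨ trans (^-*-assoc V j 2) (cong (V ^_) (*-comm j 2)) ⟩
  V ^ t                        ≤⟨ *-cancelʳ-≤ (V ^ t) _ ((q ^ N) ^ t) {{m^n≢0 (q ^ N) t {{m^n≢0 q N}}}} scaled ⟩
  -- The crude bound `q < 2 ^ q` suffices: the resulting exponent `q * d * t` equals
  -- `8 * (j * j) * d`, which is below `N`.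
  2 ^ N * (q ^ d) ^ t          ≤⟨ *-monoʳ-≤ (2 ^ N) (^-monoˡ-≤ t (^-monoˡ-≤ d (<⇒≤ (n<2^n q)))) ⟩
  2 ^ N * ((2 ^ q) ^ d) ^ t
    ≡⟨ cong (2 ^ N *_) (trans (cong (_^ t) (^-*-assoc 2 q d)) (^-*-assoc 2 (q * d) t)) ⟩
  2 ^ N * 2 ^ (q * d * t)
    <⟨ *-monoʳ-< (2 ^ N) {{m^n≢0 2 N}} (^-monoʳ-< 2 (s≤s (s≤s z≤n)) (subst (_< N) (sym exponent) small)) ⟩
  2 ^ N * 2 ^ N                ≡⟨ cong (2 ^ N *_) (*-identityʳ _) ⟨
  (2 ^ N) ^ 2                  ∎)
  where
  open ≤-Reasoning
  open +-*-Solver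
  V = ballSize N d
  t = 2 * j
  q = 2 * t
  exponent : q * d * t ≡ 8 * (j * j) * d
  exponent = solve 2 (λ j d → con 2 :* (con 2 :* j) :* d :* (con 2 :* j) := con 8 :* (j :* j) :* d) refl j d
  scaled : V ^ t * (q ^ N) ^ t ≤ 2 ^ N * (q ^ d) ^ t * (q ^ N) ^ t
  scaled = begin
    V ^ t * (q ^ N) ^ t                ≡⟨ ^-distribʳ-* V (q ^ N) t ⟨
    (V * q ^ N) ^ t                    ≤⟨ ^-monoˡ-≤ t (ballSize-bound q N d) ⟩
    (suc q ^ N * q ^ d) ^ t            ≡⟨ ^-distribʳ-* (suc q ^ N) (q ^ d) t ⟩
    (suc q ^ N) ^ t * (q ^ d) ^ t      ≡⟨ cong (_* (q ^ d) ^ t) (^-swap (suc q) N t) ⟩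
    (suc q ^ t) ^ N * (q ^ d) ^ t
      ≤⟨ *-monoˡ-≤ ((q ^ d) ^ t) (^-monoˡ-≤ N (suc-power≤double q t (n≤1+n q))) ⟩
    (2 * q ^ t) ^ N * (q ^ d) ^ t      ≡⟨ cong (_* (q ^ d) ^ t) (^-distribʳ-* 2 (q ^ t) N) ⟩
    2 ^ N * (q ^ t) ^ N * (q ^ d) ^ t  ≡⟨ cong (λ x → 2 ^ N * x * (q ^ d) ^ t) (^-swap q t N) ⟩
    2 ^ N * (q ^ N) ^ t * (q ^ d) ^ t
      ≡⟨ solve 3 (λ x y z → x :* y :* z := x :* z :* y) refl (2 ^ N) ((q ^ N) ^ t) ((q ^ d) ^ t) ⟩
    2 ^ N * (q ^ d) ^ t * (q ^ N) ^ t  ∎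

-- Bounds on M

M≤2^ : (L : Graph m) → ∀ n → M L n ≤ 2 ^ pairs n
M≤2^ L n with (𝒢 , family) , _ ← M-isMaximum L n =
  Fin.injective⇒≤ {f = wordIndex ∘ toWord ∘ 𝒢} λ {i} {j} eq →
    decidable-stable (i Fin.≟ j) λ i≢j →
      proj₁ (family i j i≢j) (toWord-injective (𝒢 i) (𝒢 j) (wordIndex-injective _ _ eq))

⊑-resp-≈ : {L : Graph m} {G H : Graph n} → G ≈ H → L ⊑ G → L ⊑ H
⊑-resp-≈ G≈H (f , inj , hom) = f , inj , λ u v uv → subst T (G≈H (f u) (f v)) (hom u v uv)

⊕-comm : (G H : Graph n) → G ⊕ H ≈ H ⊕ G
⊕-comm G H u v = Bool.xor-comm (adj G u v) (adj H u v)

addMember : (L : Graph m) {k : ℕ} (𝒢 : Fin k → Graph n) → IsFamily L 𝒢 → (H : Graph n) →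
  (∀ i → ¬ (H ≈ 𝒢 i) × L ⊑ H ⊕ 𝒢 i) → HasFamily L n (suc k)
addMember {n = n} L {k} 𝒢 family H new = 𝒢⁺ , family⁺
  where
  𝒢⁺ : Fin (suc k) → Graph n
  𝒢⁺ zero    = H
  𝒢⁺ (suc i) = 𝒢 i
  family⁺ : IsFamily L 𝒢⁺
  family⁺ zero    zero    0≢0 = contradiction refl 0≢0
  family⁺ zero    (suc j) _   = new j
  family⁺ (suc i) zero    _   = (λ 𝒢i≈H → proj₁ (new i) λ u v → sym (𝒢i≈H u v))
    , ⊑-resp-≈ {L = L} {G = H ⊕ 𝒢 i} {𝒢 i ⊕ H} (⊕-comm H (𝒢 i)) (proj₂ (new i))
  family⁺ (suc i) (suc j) i≢j = family i j (i≢j ∘ cong suc)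

⊕-cancelʳ : (G G′ H : Graph n) → G ⊕ H ≈ G′ ⊕ H → G ≈ G′
⊕-cancelʳ G G′ H eq u v = cancel (adj G u v) (adj G′ u v) (adj H u v) (eq u v)
  where
  cancel : ∀ a b c → a xor c ≡ b xor c → a ≡ b
  cancel false false c     _  = refl
  cancel true  true  c     _  = refl
  cancel false true  false ()
  cancel false true  true  ()
  cancel true  false false ()
  cancel true  false true  ()

-- By maximality the balls of radius d around the members of a largest family cover all graphs.
covering : (L : Graph m) → ∀ n d → (∀ G → d < weight (toWord G) → L ⊑ G) →
  2 ^ pairs n ≤ M L n * ballSize (pairs n) d
covering L n d dense⇒L with (𝒢 , family) , maximal ← M-isMaximum L n =
  Fin.injective⇒≤ {f = index} λ {c} {c′} → index-injective c c′
  where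
  nearest : ∀ G → ∃[ i ] weight (toWord (G ⊕ 𝒢 i)) ≤ d
  nearest G with Fin.any? (λ i → weight (toWord (G ⊕ 𝒢 i)) ≤? d)
  ... | yes found = found
  ... | no none   = contradiction
    (maximal _ (addMember L 𝒢 family G λ i →
      -- Distinctness is automatic: a graph equal to a member lies at distance 0 from it.
      (λ G≈𝒢i → none (i , ≤-trans (≤-reflexive (edgeless⇒weight≡0 (G ⊕ 𝒢 i) λ u v →
        trans (cong (_xor adj (𝒢 i) u v) (G≈𝒢i u v)) (Bool.xor-same (adj (𝒢 i) u v)))) z≤n))
      , dense⇒L (G ⊕ 𝒢 i) (≰⇒> λ close → none (i , close))))
    (<⇒≱ (n<1+n _))

  graphAt : Fin (2 ^ pairs n) → Graph n
  graphAt c = fromWord n (wordAt c)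

  index : Fin (2 ^ pairs n) → Fin (M L n * ballSize (pairs n) d)
  index c with i , close ← nearest (graphAt c) = combine i (ballIndex (toWord (graphAt c ⊕ 𝒢 i)) close)

  index-injective : ∀ c c′ → index c ≡ index c′ → c ≡ c′
  index-injective c c′ eq
    with i , close ← nearest (graphAt c) | i′ , close′ ← nearest (graphAt c′)
    -- Equal indices mean equal centres, after which the difference to the centre determines the
    -- graph.
    with refl , same ← Fin.combine-injective i _ i′ _ eq
    = wordAt-injective {pairs n} c c′ (begin
        wordAt c             ≡⟨ toWord-fromWord n (wordAt c) ⟨
        toWord (graphAt c)   ≡⟨ toWord-cong (⊕-cancelʳ (graphAt c) (graphAt c′) (𝒢 i)
                                  (toWord-injective _ _ (ballIndex-injective _ _ close close′ same))) ⟩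
        toWord (graphAt c′)  ≡⟨ toWord-fromWord n (wordAt c′) ⟩
        wordAt c′            ∎)
    where open ≡-Reasoning

-- Asymptotics

pairs-double : ∀ n → 2 * pairs n + n ≡ n * n
pairs-double zero    = refl
pairs-double (suc n) = begin
  2 * (n + pairs n) + suc n
    ≡⟨ solve 2 (λ n p → con 2 :* (n :+ p) :+ (con 1 :+ n) := con 1 :+ (con 2 :* n :+ (con 2 :* p :+ n))) refl n (pairs n) ⟩
  1 + (2 * n + (2 * pairs n + n))
    ≡⟨ cong (λ x → 1 + (2 * n + x)) (pairs-double n) ⟩
  1 + (2 * n + n * n)
    ≡⟨ solve 1 (λ n → con 1 :+ (con 2 :* n :+ n :* n) := (con 1 :+ n) :* (con 1 :+ n)) refl n ⟩
  suc n * suc n ∎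
  where
  open ≡-Reasoning
  open +-*-Solver

-- The left side is at most `n²/4`, which is below `n(n-1)/2` as soon as `n > 2`.
radius<pairs : ∀ a n D → 2 < n → 4 * a * D ≤ n → a * (n * D) < pairs n
radius<pairs a n D 2<n D≤ = *-cancelˡ-< 4 _ _ (+-cancelʳ-< (2 * n) _ _ (begin-strict
  4 * (a * (n * D)) + 2 * n
    ≡⟨ cong (_+ 2 * n) (solve 3 (λ a n d → con 4 :* (a :* (n :* d)) := n :* (con 4 :* a :* d)) refl a n D) ⟩
  n * (4 * a * D) + 2 * n      ≤⟨ +-monoˡ-≤ (2 * n) (*-monoʳ-≤ n D≤) ⟩
  n * n + 2 * n                <⟨ +-monoʳ-< (n * n) (*-monoˡ-< n {{>-nonZero (<-trans z<s 2<n)}} 2<n) ⟩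
  n * n + n * n                ≡⟨ cong (λ x → x + x) (pairs-double n) ⟨
  (2 * pairs n + n) + (2 * pairs n + n)
    ≡⟨ solve 2 (λ p n → (con 2 :* p :+ n) :+ (con 2 :* p :+ n) := con 4 :* p :+ con 2 :* n) refl (pairs n) n ⟩
  4 * pairs n + 2 * n          ∎))
  where
  open ≤-Reasoning
  open +-*-Solver

-- Rounding down loses at most a factor 2, since the quotient is at least 1.
≤2*quotient : ∀ n κ → .{{_ : NonZero κ}} → κ ≤ n → n ≤ 2 * κ * (n / κ)
≤2*quotient n κ κ≤n = begin
  n                          ≡⟨ m≡m%n+[m/n]*n n κ ⟩
  n % κ + n / κ * κ        ≤⟨ +-monoˡ-≤ _ (<⇒≤ (m%n<n n κ)) ⟩
  κ + n / κ * κ              ≤⟨ +-monoˡ-≤ _ (m≤n*m κ (n / κ) {{>-nonZero (m≥n⇒m/n>0 κ≤n)}}) ⟩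
  n / κ * κ + n / κ * κ
    ≡⟨ solve 2 (λ q k → q :* k :+ q :* k := con 2 :* k :* q) refl (n / κ) κ ⟩
  2 * κ * (n / κ)            ∎
  where
  open ≤-Reasoning
  open +-*-Solver

-- n·m^b ≤ Q·n^b says that m = O(n^(1-1/b)).
module _ (r b Q κ : ℕ) where
  private
    t E F₁ F₂ : ℕ
    -- `t` makes `m ^ t` the power `suc r` of `m ^ b`. `E` is the loss in passing from `n ^ suc t`
    -- to `D ^ suc t`. `F₁` and `F₂` are what `n` must exceed to keep each term of
    -- `choice-condition` within half of the bound.
    t = b * suc r
    E = κ ^ suc t
    F₁ = (2 * E) ^ b * Q
    F₂ = 2 * E * (2 ^ t * Q ^ suc r)

  threshold : ℕ
  threshold = suc (F₁ + F₂)

  module _ (n m D : ℕ) (n≥ : threshold ≤ n) (n≤κD : n ≤ κ * D) (m-small : n * m ^ b ≤ Q * n ^ b) where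
    open ≤-Reasoning
    open +-*-Solver

    private
      n≢0 : NonZero n
      n≢0 = >-nonZero (≤-trans z<s n≥)

    -- After raising to the power `b` and multiplying by `n`, the extra factor `n` beats the
    -- constant `F₁`.
    sublinear : 2 * E * m < n
    sublinear = ^-cancelˡ-< b (*-cancelˡ-< n _ _ (begin-strict
      n * (2 * E * m) ^ b          ≡⟨ cong (n *_) (^-distribʳ-* (2 * E) m b) ⟩
      n * ((2 * E) ^ b * m ^ b)    ≡⟨ solve 3 (λ n e m → n :* (e :* m) := e :* (n :* m)) refl n ((2 * E) ^ b) (m ^ b) ⟩
      (2 * E) ^ b * (n * m ^ b)    ≤⟨ *-monoʳ-≤ ((2 * E) ^ b) m-small ⟩
      (2 * E) ^ b * (Q * n ^ b)    ≡⟨ *-assoc ((2 * E) ^ b) Q (n ^ b) ⟨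
      F₁ * n ^ b                   <⟨ *-monoˡ-< (n ^ b) {{m^n≢0 n b {{n≢0}}}} (<-≤-trans (s≤s (m≤m+n F₁ F₂)) n≥) ⟩
      n * n ^ b                    ∎))

    -- The power `suc r` of `m-small` bounds `n ^ suc r * m ^ t` by `Q ^ suc r * n ^ t`; the
    -- constants collect in `F₂`, which is at most `n`.
    few-poor : 2 * E * (n ^ r * n * (m + m) ^ t) ≤ n * n ^ t
    few-poor = begin
      2 * E * (n ^ r * n * (m + m) ^ t)
        ≡⟨ cong₂ (λ x y → 2 * E * (x * y)) (*-comm (n ^ r) n)
             (trans (cong (λ x → (m + x) ^ t) (sym (+-identityʳ m))) (^-distribʳ-* 2 m t)) ⟩
      2 * E * (n ^ suc r * (2 ^ t * m ^ t))
        ≡⟨ solve 4 (λ e n p m → e :* (n :* (p :* m)) := e :* p :* (n :* m)) refl (2 * E) (n ^ suc r) (2 ^ t) (m ^ t) ⟩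
      2 * E * 2 ^ t * (n ^ suc r * m ^ t)
        ≡⟨ cong (λ x → 2 * E * 2 ^ t * (n ^ suc r * x)) (^-*-assoc m b (suc r)) ⟨
      2 * E * 2 ^ t * (n ^ suc r * (m ^ b) ^ suc r)
        ≡⟨ cong (2 * E * 2 ^ t *_) (^-distribʳ-* n (m ^ b) (suc r)) ⟨
      2 * E * 2 ^ t * (n * m ^ b) ^ suc r
        ≤⟨ *-monoʳ-≤ (2 * E * 2 ^ t) (^-monoˡ-≤ (suc r) m-small) ⟩
      2 * E * 2 ^ t * (Q * n ^ b) ^ suc r
        ≡⟨ cong (2 * E * 2 ^ t *_) (trans (^-distribʳ-* Q (n ^ b) (suc r)) (cong (Q ^ suc r *_) (^-*-assoc n b (suc r)))) ⟩
      2 * E * 2 ^ t * (Q ^ suc r * n ^ t)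
        ≡⟨ solve 4 (λ e p c n → e :* p :* (c :* n) := e :* (p :* c) :* n) refl (2 * E) (2 ^ t) (Q ^ suc r) (n ^ t) ⟩
      F₂ * n ^ t
        ≤⟨ *-monoˡ-≤ (n ^ t) (≤-trans (≤-trans (m≤n+m F₂ F₁) (n≤1+n _)) n≥) ⟩
      n * n ^ t ∎

    choice-condition : n ^ t * m + n ^ r * n * (m + m) ^ t < D ^ suc t
    choice-condition = *-cancelˡ-< (2 * E) _ _ (begin-strict
      2 * E * (n ^ t * m + n ^ r * n * (m + m) ^ t)
        ≡⟨ solve 4 (λ e p m x → e :* (p :* m :+ x) := e :* m :* p :+ e :* x) refl (2 * E) (n ^ t) m (n ^ r * n * (m + m) ^ t) ⟩
      2 * E * m * n ^ t + 2 * E * (n ^ r * n * (m + m) ^ t)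
        <⟨ +-mono-<-≤ (*-monoˡ-< (n ^ t) {{m^n≢0 n t {{n≢0}}}} sublinear) few-poor ⟩
      n * n ^ t + n * n ^ t        ≡⟨ solve 1 (λ x → x :+ x := con 2 :* x) refl (n ^ suc t) ⟩
      2 * n ^ suc t                ≤⟨ *-monoʳ-≤ 2 (^-monoˡ-≤ (suc t) n≤κD) ⟩
      2 * (κ * D) ^ suc t          ≡⟨ cong (2 *_) (^-distribʳ-* κ D (suc t)) ⟩
      2 * (E * D ^ suc t)          ≡⟨ *-assoc 2 E (D ^ suc t) ⟨
      2 * E * D ^ suc t            ∎)

-- Logarithms

-- `mkℚᵘ` stores the denominator minus one, so `mkℚᵘ (ℤ.+ a) a` is `a/(a+1)`. The last hypothesis is
-- `a·N/(a+1) < log₂ K` with the fraction cleared.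
log-lower : ∀ K N → .{{_ : NonZero K}} → .{{_ : NonZero N}} → ∀ a p → p ℚ.< mkℚᵘ (ℤ.+ a) a →
  2 ^ (a * N) < K ^ suc a → p <ᴿ log₂ K /ᴿ N
log-lower K N@(suc _) a p p< lt = lower-closed K {p ℚ.* D} {mkℚᵘ (ℤ.+ a) a ℚ.* D}
  (ℚ.*-monoˡ-<-pos D p<)
  (lower-resp (log₂ K) {mkℚᵘ (ℤ.+ (a * N)) a} {mkℚᵘ (ℤ.+ a) a ℚ.* D}
    (*≡* (cong₂ ℤ._*_ (ℤ.pos-* a N) (cong ℤ.+_ (*-identityʳ (suc a)))))
    (subst (2 ^ (a * N) <_) (sym (*-identityʳ (K ^ suc a))) lt))
  where
  D = ℤ.+ N ℚ./ 1

log-upper : ∀ K N → .{{_ : NonZero K}} → .{{_ : NonZero N}} → ∀ p → 1ℚᵘ ℚ.< p →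
  K ≤ 2 ^ N → log₂ K /ᴿ N ᴿ< p
log-upper K N@(suc _) p 1<p K≤ = ¬lower⇒upper K {D} {p ℚ.* D}
  (ℚ.<-respˡ-≃ (ℚ.*-identityˡ D) (ℚ.*-monoˡ-<-pos D 1<p))
  (≤⇒≯ (≤-trans (≤-reflexive (trans (*-identityʳ (K ^ 1)) (*-identityʳ K))) K≤))
  where
  D = ℤ.+ N ℚ./ 1

-- With `d` the denominator of `δ`, positivity gives `δ ≥ 1/d > 1/(d+1)`, and the right side is
-- `1 - 1/(d+1)`, the form that `log-lower` takes.
1-δ< : ∀ δ → 0ℚᵘ ℚ.< δ → 1ℚᵘ ℚ.- δ ℚ.< mkℚᵘ (ℤ.+ (↧ₙ δ)) (↧ₙ δ)
1-δ< (mkℚᵘ (ℤ.+ zero) q)  (ℚ.*<* (ℤ.+<+ ()))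
1-δ< δ@(mkℚᵘ (ℤ.+ suc a) q) 0<δ = ℚ.<-respʳ-≃ {1ℚᵘ ℚ.- δ}
  (*≡* (cong₂ (λ x y → ℤ.+ x ℤ.* ℤ.+ y) (+-identityʳ (suc q)) (sym (+-identityʳ (2+ q)))))
  (ℚ.+-monoʳ-< 1ℚᵘ {ℚ.- δ} {ℚ.- mkℚᵘ (ℤ.+ 1) (suc q)} (ℚ.neg-mono-< 1/[1+q]<δ))
  where
  1/[1+q]<δ : mkℚᵘ (ℤ.+ 1) (suc q) ℚ.< δ
  1/[1+q]<δ = ⁺⁻⇒< {mkℚᵘ (ℤ.+ 1) (suc q)} {δ} (begin-strict
    1 * suc q + 0              ≡⟨ +-identityʳ (1 * suc q) ⟩
    1 * suc q                  <⟨ *-monoʳ-< 1 (n<1+n (suc q)) ⟩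
    1 * 2+ q                   ≤⟨ *-monoˡ-≤ (2+ q) {1} {suc a} (s≤s z≤n) ⟩
    suc a * 2+ q               ≤⟨ m≤m+n _ 0 ⟩
    suc a * 2+ q + 0           ∎)
    where open ≤-Reasoning

-- Here `K ≥ 2^N / V` and `V < 2^(N/(a+1))`; taking powers with exponent `suc a` avoids roots.
M-lower : ∀ a K V N → .{{NonZero K}} → 2 ^ N ≤ K * V → V ^ suc a < 2 ^ N → 2 ^ (a * N) < K ^ suc a
M-lower a K V N covered small = *-cancelʳ-< (2 ^ N) _ _ (begin-strict
  2 ^ (a * N) * 2 ^ N    ≡⟨ *-comm (2 ^ (a * N)) (2 ^ N) ⟩
  2 ^ N * 2 ^ (a * N)    ≡⟨ ^-distribˡ-+-* 2 N (a * N) ⟨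
  2 ^ (suc a * N)        ≡⟨ cong (2 ^_) (*-comm (suc a) N) ⟩
  2 ^ (N * suc a)        ≡⟨ ^-*-assoc 2 N (suc a) ⟨
  (2 ^ N) ^ suc a        ≤⟨ ^-monoˡ-≤ (suc a) covered ⟩
  (K * V) ^ suc a        ≡⟨ ^-distribʳ-* K V (suc a) ⟩
  K ^ suc a * V ^ suc a  <⟨ *-monoʳ-< (K ^ suc a) {{m^n≢0 K (suc a)}} small ⟩
  K ^ suc a * 2 ^ N      ∎)
  where open ≤-Reasoning

-- Replacing the real exponent by whole powers

1-[1-p]≃p : ∀ p → 1ℚᵘ ℚ.- (1ℚᵘ ℚ.- p) ℚ.≃ p
1-[1-p]≃p p = begin
  1ℚᵘ ℚ.- (1ℚᵘ ℚ.- p)              ≡⟨ cong (1ℚᵘ ℚ.+_) (ℚ.neg-distrib-+ 1ℚᵘ (ℚ.- p)) ⟩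
  1ℚᵘ ℚ.+ (ℚ.- 1ℚᵘ ℚ.- ℚ.- p)      ≈⟨ ℚ.+-assoc 1ℚᵘ (ℚ.- 1ℚᵘ) (ℚ.- ℚ.- p) ⟨
  (1ℚᵘ ℚ.- 1ℚᵘ) ℚ.+ ℚ.- ℚ.- p      ≈⟨ ℚ.+-congˡ (ℚ.- ℚ.- p) (ℚ.+-inverseʳ 1ℚᵘ) ⟩
  0ℚᵘ ℚ.+ ℚ.- ℚ.- p                ≈⟨ ℚ.+-identityˡ (ℚ.- ℚ.- p) ⟩
  ℚ.- ℚ.- p                        ≈⟨ ℚ.neg-involutive p ⟩
  p                                ∎
  where open ℚ.≃-Reasoning

-- Roundedness of the cut gives a rational `p` with `0 < p < ε`, and `s = 1 - p` works. The growth
-- hypothesis is applied at this exponent.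
exponent<1 : ∀ ε → 0ℚᵘ <ᴿ ε → ∃[ s ] s ℚ.< 1ℚᵘ × (1ℚᵘ -ᴿ ε) ᴿ< s
exponent<1 ε 0<ε with p , 0<p , p<ε ← Equivalence.to (ℝ.lower-rounded ε 0ℚᵘ) 0<ε =
  1ℚᵘ ℚ.- p
  , ℚ.<-respʳ-≃ (ℚ.+-identityʳ 1ℚᵘ) (ℚ.+-monoʳ-< 1ℚᵘ (ℚ.neg-mono-< 0<p))
  , lower-resp ε (ℚ.≃-sym (1-[1-p]≃p p)) p<ε

-- For `s = i/b < 1` the integer `i` is at most `b - 1`, which frees one factor `n`.
clear-exponent : ∀ m c n s → .{{NonZero n}} → s ℚ.< 1ℚᵘ → m ≤ c · n ^ℚ s →
  n * m ^ ↧ₙ s ≤ c ^ ↧ₙ s * n ^ ↧ₙ s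
clear-exponent m c n s@(mkℚᵘ i b-1) s<1 m≤ = begin
  n * m ^ b                  ≤⟨ *-monoʳ-≤ n (m≤m*n (m ^ b) (n ^ i ⁻) {{m^n≢0 n (i ⁻)}}) ⟩
  n * (m ^ b * n ^ i ⁻)      ≤⟨ *-monoʳ-≤ n m≤ ⟩
  n * (c ^ b * n ^ i ⁺)      ≤⟨ *-monoʳ-≤ n (*-monoʳ-≤ (c ^ b) (^-monoʳ-≤ n (numerator i s<1))) ⟩
  n * (c ^ b * n ^ b-1)      ≡⟨ solve 3 (λ n c p → n :* (c :* p) := c :* (n :* p)) refl n (c ^ b) (n ^ b-1) ⟩
  c ^ b * n ^ b              ∎
  where
  open ≤-Reasoning
  open +-*-Solver
  b = suc b-1
  numerator : ∀ i → mkℚᵘ i b-1 ℚ.< 1ℚᵘ → i ⁺ ≤ b-1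
  numerator (ℤ.+ a)    lt = ≤-pred (subst₂ _<_ (trans (+-identityʳ (a * 1)) (*-identityʳ a))
    (trans (+-identityʳ (1 * b)) (*-identityˡ b)) (<⇒⁺⁻ {mkℚᵘ (ℤ.+ a) b-1} {1ℚᵘ} lt))
  numerator ℤ.-[1+ a ] _  = z≤n

theorem1p6 : (r : ℕ) .{{_ : NonZero r}} →
    (ε : ℝ) → 0ℚᵘ <ᴿ ε →
    (m : ℕ → ℕ) (L : ∀ n → Graph (m n)) (A B : ∀ n → Subset (m n)) →
    (∀ n → IsL r (L n) (A n) (B n)) →
    m =O[n^ 1ℚᵘ -ᴿ ε ] →
    (λ n → log₂ (M (L n) n) /ᴿ (n C 2)) ⟶ 1ℚᵘ
theorem1p6 r ε 0<ε m L A B isL (c , n₀ , m≤) δ 0<δ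
  with s , s<1 , 1-ε<s ← exponent<1 ε 0<ε
  = n₁ , λ n n₁≤n → close n n₁≤n
  where
  a b Q j κ n₁ : ℕ
  -- The limit is bounded below through `a/(a+1)`, so ball sizes are raised to the power
  -- `j = a + 1`. With `D = n / κ`, the factors 4 and `8 * (j * j)` of `κ` are those of
  -- `radius<pairs` and `ballSize-small`. The `2 * κ` in `threshold` allows for rounding.
  a = ↧ₙ δ
  b = ↧ₙ s
  Q = c ^ b
  j = suc a
  κ = 4 * (8 * (j * j))
  n₁ = (3 + n₀) + (κ + threshold r b Q (2 * κ))

  close : ∀ n → n₁ ≤ n → (1ℚᵘ ℚ.- δ <ᴿ log₂ (M (L n) n) /ᴿ (n C 2)) × (log₂ (M (L n) n) /ᴿ (n C 2) ᴿ< 1ℚᵘ ℚ.+ δ)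
  close n n₁≤n = subst (λ N → (1ℚᵘ ℚ.- δ <ᴿ log₂ K /ᴿ N) × (log₂ K /ᴿ N ᴿ< 1ℚᵘ ℚ.+ δ)) (pairs≡C2 n)
    ( log-lower K (pairs n) a (1ℚᵘ ℚ.- δ) (1-δ< δ 0<δ)
        (M-lower a K (ballSize (pairs n) (n * D)) (pairs n) (covering (L n) n (n * D) dense)
          (ballSize-small j (pairs n) (n * D) radius))
    , log-upper K (pairs n) (1ℚᵘ ℚ.+ δ)
        (ℚ.<-respˡ-≃ (ℚ.+-identityʳ 1ℚᵘ) (ℚ.+-monoʳ-< 1ℚᵘ 0<δ)) (M≤2^ (L n) n))
    where
    K D : ℕ
    K = M (L n) n
    D = n / κ
    2<n : 2 < n
    2<n = ≤-trans (≤-trans (m≤m+n 3 n₀) (m≤m+n _ _)) n₁≤n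
    n₀≤n : n₀ ≤ n
    n₀≤n = ≤-trans (≤-trans (m≤n+m n₀ 3) (m≤m+n _ _)) n₁≤n
    κ≤n : κ ≤ n
    κ≤n = ≤-trans (≤-trans (m≤m+n κ _) (m≤n+m _ (3 + n₀))) n₁≤n
    threshold≤n : threshold r b Q (2 * κ) ≤ n
    threshold≤n = ≤-trans (≤-trans (m≤n+m _ κ) (m≤n+m _ (3 + n₀))) n₁≤n
    instance
      n≢0 : NonZero n
      n≢0 = >-nonZero (<-trans z<s 2<n)
    radius : 8 * (j * j) * (n * D) < pairs n
    radius = radius<pairs (8 * (j * j)) n D 2<n (≤-trans (≤-reflexive (*-comm κ D)) (m/n*n≤m n κ))
    instance
      pairs≢0 : NonZero (pairs n)
      pairs≢0 = >-nonZero (≤-<-trans z≤n radius)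
    dense : ∀ G → n * D < weight (toWord G) → L n ⊑ G
    dense G nD<w = dense⇒⊒ (isL n) G D (b * suc r)
      (≤-trans (*-monoʳ-≤ 2 (<⇒≤ nD<w)) (≤-reflexive (sym (handshake G))))
      (choice-condition r b Q (2 * κ) n (m n) D threshold≤n (≤2*quotient n κ κ≤n)
        (clear-exponent (m n) c n s s<1 (m≤ n n₀≤n s 1-ε<s)))
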